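{- $L\star\delta_\bullet=\log^*\delta$ as linear forms on $\mathcal H_{CK}$.
   Context: Let $k$ be a field of characteristic $0$. Rooted trees are finite and non-planar; $\bullet$ is the one-vertex tree; $B_+(t_1\cdots t_n)$ is the tree obtained by joining the roots of $t_1,\dots,t_n$ to a new root. The tree factorial is defined by $\bullet!=1$ and $B_+(t_1\cdots t_n)!=v(B_+(t_1\cdots t_n))\prod_j t_j!$, $v$ = number of vertices. (1) $\mathcal H$ is the free commutative $k$-algebra generated by isomorphism classes of rooted trees with at least one edge, with unit identified with $\bullet$. A subforest of a rooted tree $t$ is either the trivial subforest $\bullet$ or a nonempty set of pairwise vertex-disjoint subtrees each with at least one edge, identified with the product of its components; $t/s$ is the tree obtained by contracting each component of $s$ to a vertex. $\mathcal H$ is a Hopf algebra with multiplicative coproduct $\Delta(t)=\sum_s s\otimes t/s$ over subforests (as subsets) and antipode $S$; $E$ is the character of $\mathcal H$ with $E(t)=1/t!$ for each tree $t$ with at least one edge, and $L=E\circ S$ is its inverse for the convolution $f\star g=(f\otimes g)\circ\Delta$. (2) $\mathcal H_{CK}$ is the Connes–Kreimer Hopf algebra of rooted forests (unit empty forest $\mathbf 1$, counit $\varepsilon$, coproduct by admissible cuts $\Delta_{CK}(u)=\sum v\otimes w$ over decompositions of the vertex set of $u$ into $V\sqcup W$ with no vertex of $V$ strictly below a vertex of $W$), with convolution $*$. $\delta$ is the character of $\mathcal H_{CK}$ with $\delta(\bullet)=1$ and $\delta(t)=0$ for trees with at least two vertices; $\log^*\delta=\sum_{n\ge1}\frac{(-1)^{n+1}}{n}(\delta-\varepsilon)^{*n}$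 (a locally finite sum). $\delta_\bullet$ takes value $1$ on the tree $\bullet$ and $0$ on all other forests. (3) $\Phi:\mathcal H_{CK}\to\mathcal H\otimes\mathcal H_{CK}$ is the algebra morphism with $\Phi(\mathbf 1)=\bullet\otimes\mathbf 1$ and $\Phi(t)=\sum_s s\otimes t/s$ over subforests of $t$ for each nonempty tree; $L\star\delta_\bullet:=(L\otimes\delta_\bullet)\circ\Phi$. -}

module Defs where

open import Algebra.Apartness.Bundles using (HeytingField; HeytingCommutativeRing)
open import Algebra.Bundles using (CommutativeRing; Semiring; CommutativeMonoid; RawMonoid)
import Algebra.Construct.DirectProduct as DirectProduct
import Algebra.Definitions.RawSemiring as RawSemiringDefinitions
open import Algebra.Module.Bundles using (LeftModule)
import Algebra.Module.Construct.TensorUnit as TensorUnit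
open import Algebra.Module.Morphism.Structures using (module LeftModuleMorphisms)
open import Data.Empty using (⊥)
open import Data.Fin.Base using (toℕ)
open import Data.List.Base using (List; []; _∷_; [_]; _++_; map; foldr; cartesianProductWith)
open import Data.List.Relation.Binary.Permutation.Homogeneous as Homogeneous using (Permutation)
open import Data.List.Relation.Binary.Pointwise.Base using (Pointwise; []; _∷_)
import Data.List.Relation.Binary.Permutation.Setoid.Properties as PermutationProperties
open import Data.Nat.Base as ℕ using (ℕ; zero; suc; NonZero; _>_)
open import Data.Nat.Properties using (m*n≢0)
open import Data.Product.Base using (_×_; _,_; proj₁; Σ; ∃-syntax)
open import Data.Product.Relation.Binary.Pointwise.NonDependent using (×-setoid)
open import Data.Unit.Base using (⊤; tt)
open import Function.Base using (_∘_; id)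
open import Level using (Level; _⊔_; 0ℓ)
open import Relation.Binary.Bundles using (Setoid)
open import Relation.Binary.Core using (Rel)
import Relation.Binary.Construct.On as On

private
  variable
    c ℓ ℓ₁ ℓ₂ a b ℓa ℓb : Level

data Tree : Set where
  B₊ : List Tree → Tree

Forest : Set
Forest = List Tree

• : Tree
• = B₊ []

-- Non-planar trees are planar representatives up to _≅_.

infix 4 _≅_

data _≅_ : Rel Tree 0ℓ where
  B₊-cong : ∀ {ts us} → Permutation _≅_ ts us → B₊ ts ≅ B₊ us

≅-refl : ∀ t → t ≅ t
≅ᶠ-refl : ∀ ts → Pointwise _≅_ ts ts
≅-refl (B₊ ts) = B₊-cong (Homogeneous.refl (≅ᶠ-refl ts))
≅ᶠ-refl []       = []
≅ᶠ-refl (t ∷ ts) = ≅-refl t ∷ ≅ᶠ-refl ts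

≅-sym : ∀ {t u} → t ≅ u → u ≅ t
≅ᶠ-sym : ∀ {ts us} → Pointwise _≅_ ts us → Pointwise _≅_ us ts
↭-sym : ∀ {ts us} → Permutation _≅_ ts us → Permutation _≅_ us ts
≅-sym (B₊-cong p) = B₊-cong (↭-sym p)
≅ᶠ-sym []       = []
≅ᶠ-sym (p ∷ ps) = ≅-sym p ∷ ≅ᶠ-sym ps
↭-sym (Homogeneous.refl ps)    = Homogeneous.refl (≅ᶠ-sym ps)
↭-sym (Homogeneous.prep p q)   = Homogeneous.prep (≅-sym p) (↭-sym q)
↭-sym (Homogeneous.swap p q r) = Homogeneous.swap (≅-sym q) (≅-sym p) (↭-sym r)
↭-sym (Homogeneous.trans p q)  = Homogeneous.trans (↭-sym q) (↭-sym p)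

≅-trans : ∀ {t u v} → t ≅ u → u ≅ v → t ≅ v
≅-trans (B₊-cong p) (B₊-cong q) = B₊-cong (Homogeneous.trans p q)

treeSetoid : Setoid 0ℓ 0ℓ
treeSetoid = record
  { Carrier       = Tree
  ; _≈_           = _≅_
  ; isEquivalence = record { refl = ≅-refl _ ; sym = ≅-sym ; trans = ≅-trans }
  }

HasEdge : Tree → Set
HasEdge (B₊ [])      = ⊥
HasEdge (B₊ (_ ∷ _)) = ⊤

Tree⁺ : Set
Tree⁺ = Σ Tree HasEdge

tree⁺Setoid : Setoid 0ℓ 0ℓ
tree⁺Setoid = On.setoid {B = Tree⁺} treeSetoid proj₁

-- The unit of the algebra ℋ below is identified with •.

tree→monomial : Tree → List Tree⁺
tree→monomial (B₊ [])       = []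
tree→monomial (B₊ (t ∷ ts)) = [ B₊ (t ∷ ts) , tt ]

∣_∣ : Tree → ℕ
∣_∣ᶠ : Forest → ℕ
∣ B₊ ts ∣ = suc ∣ ts ∣ᶠ
∣ [] ∣ᶠ     = 0
∣ t ∷ ts ∣ᶠ = ∣ t ∣ ℕ.+ ∣ ts ∣ᶠ

infix 8 _! _!ᶠ

_! : Tree → ℕ
_!ᶠ : Forest → ℕ
B₊ ts ! = ∣ B₊ ts ∣ ℕ.* ts !ᶠ
[] !ᶠ       = 1
(t ∷ ts) !ᶠ = t ! ℕ.* ts !ᶠ

!-nonZero : ∀ t → NonZero (t !)
!ᶠ-nonZero : ∀ ts → NonZero (ts !ᶠ)
!-nonZero (B₊ ts) = m*n≢0 ∣ B₊ ts ∣ (ts !ᶠ) ⦃ _ ⦄ ⦃ !ᶠ-nonZero ts ⦄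
!ᶠ-nonZero []       = _
!ᶠ-nonZero (t ∷ ts) = m*n≢0 (t !) (ts !ᶠ) ⦃ !-nonZero t ⦄ ⦃ !ᶠ-nonZero ts ⦄

-- A set of pairwise vertex-disjoint subtrees, each with at least one edge,
-- is determined by the set of edges it covers, and any set of edges arises in
-- this way (the empty one from the trivial subforest).  So a subforest is
-- recorded by saying, for each edge, whether it is kept in the subforest.

data Subforest : Tree → Set
data Branches : Forest → Set

data Subforest where
  join : ∀ {ts} → Branches ts → Subforest (B₊ ts)

-- Branches ts: choices for the trees ts and for the edges joining their
-- roots to a common parent.

data Branches where
  []   : Branches []
  keep : ∀ {t ts} → Subforest t → Branches ts → Branches (t ∷ ts)
  omit : ∀ {t ts} → Subforest t → Branches ts → Branches (t ∷ ts)

-- The component through the root (possibly a single vertex).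

rootComponent : ∀ {t} → Subforest t → Tree
keptBranches : ∀ {ts} → Branches ts → Forest
rootComponent (join bs) = B₊ (keptBranches bs)
keptBranches []          = []
keptBranches (keep s bs) = rootComponent s ∷ keptBranches bs
keptBranches (omit s bs) = keptBranches bs

-- The product of the components, as a monomial of ℋ.  When an edge is kept,
-- the root component of its upper end has already been counted below.

components : ∀ {t} → Subforest t → List Tree⁺
otherComponents : ∀ {t} → Subforest t → List Tree⁺
branchComponents : ∀ {ts} → Branches ts → List Tree⁺
components s = tree→monomial (rootComponent s) ++ otherComponents s
otherComponents (join bs) = branchComponents bs
branchComponents []          = []
branchComponents (keep s bs) = otherComponents s ++ branchComponents bs
branchComponents (omit s bs) =
  (tree→monomial (rootComponent s) ++ otherComponents s) ++ branchComponents bs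

-- The contracted tree t / s.  Contracting a kept edge hands the branches of
-- its upper end over to its lower end.

contract : ∀ {t} → Subforest t → Tree
contractedBranches : ∀ {t} → Subforest t → Forest
contractBranches : ∀ {ts} → Branches ts → Forest
contract s = B₊ (contractedBranches s)
contractedBranches (join bs) = contractBranches bs
contractBranches []          = []
contractBranches (keep s bs) = contractedBranches s ++ contractBranches bs
contractBranches (omit s bs) = B₊ (contractedBranches s) ∷ contractBranches bs

subforests : ∀ t → List (Subforest t)
branches : ∀ ts → List (Branches ts)
subforests (B₊ ts) = map join (branches ts)
branches []       = [ [] ]
branches (t ∷ ts) =
  cartesianProductWith keep (subforests t) (branches ts) ++
  cartesianProductWith omit (subforests t) (branches ts)

-- Decompositions V ⊔ W of the vertex set of a forest with no vertex of V
-- strictly below a vertex of W.  Roots are the lowest vertices, so a tree whose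
-- root is in V lies entirely in V.

data Decomposition : Forest → Set where
  []      : Decomposition []
  allInV  : ∀ {t ts} → Decomposition ts → Decomposition (t ∷ ts)
  rootInW : ∀ {us ts} → Decomposition us → Decomposition ts → Decomposition (B₊ us ∷ ts)

V-part : ∀ {ts} → Decomposition ts → Forest
V-part []                = []
V-part (allInV {t} d)    = t ∷ V-part d
V-part (rootInW d₁ d₂)   = V-part d₁ ++ V-part d₂

W-part : ∀ {ts} → Decomposition ts → Forest
W-part []                = []
W-part (allInV d)        = W-part d
W-part (rootInW d₁ d₂)   = B₊ (W-part d₁) ∷ W-part d₂

decompositions : ∀ ts → List (Decomposition ts)
decompositions []             = [ [] ]
decompositions (B₊ us ∷ ts) =
  map allInV (decompositions ts) ++
  cartesianProductWith rootInW (decompositions us) (decompositions ts)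

module Free (R : CommutativeRing c ℓ) where

  open CommutativeRing R hiding (setoid)

  infixl 6 _⊕_
  infixr 7 _⊙_

  data FreeModule (B : Setoid b ℓb) : Set (c ⊔ b) where
    η   : Setoid.Carrier B → FreeModule B
    𝟎   : FreeModule B
    _⊕_ : FreeModule B → FreeModule B → FreeModule B
    _⊙_ : Carrier → FreeModule B → FreeModule B

  module _ {B : Setoid b ℓb} where

    infix 4 _≋_

    data _≋_ : Rel (FreeModule B) (c ⊔ ℓ ⊔ b ⊔ ℓb) where
      ≋-refl      : ∀ {x} → x ≋ x
      ≋-sym       : ∀ {x y} → x ≋ y → y ≋ x
      ≋-trans     : ∀ {x y z} → x ≋ y → y ≋ z → x ≋ z
      η-cong      : ∀ {i j} → Setoid._≈_ B i j → η i ≋ η j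
      ⊕-cong      : ∀ {x x′ y y′} → x ≋ x′ → y ≋ y′ → x ⊕ y ≋ x′ ⊕ y′
      ⊕-assoc     : ∀ x y z → (x ⊕ y) ⊕ z ≋ x ⊕ (y ⊕ z)
      ⊕-comm      : ∀ x y → x ⊕ y ≋ y ⊕ x
      ⊕-identityˡ : ∀ x → 𝟎 ⊕ x ≋ x
      ⊙-cong      : ∀ {r r′ x x′} → r ≈ r′ → x ≋ x′ → r ⊙ x ≋ r′ ⊙ x′
      ⊙-zeroˡ     : ∀ x → 0# ⊙ x ≋ 𝟎
      ⊙-zeroʳ     : ∀ r → r ⊙ 𝟎 ≋ 𝟎
      ⊙-distribʳ  : ∀ x r s → (r + s) ⊙ x ≋ r ⊙ x ⊕ s ⊙ x
      ⊙-distribˡ  : ∀ r x y → r ⊙ (x ⊕ y) ≋ r ⊙ x ⊕ r ⊙ y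
      ⊙-assoc     : ∀ r s x → (r * s) ⊙ x ≋ r ⊙ (s ⊙ x)
      ⊙-identityˡ : ∀ x → 1# ⊙ x ≋ x

    ⊕-inverseˡ : ∀ x → (- 1#) ⊙ x ⊕ x ≋ 𝟎
    ⊕-inverseˡ x =
      ≋-trans (⊕-cong ≋-refl (≋-sym (⊙-identityˡ x)))
      (≋-trans (≋-sym (⊙-distribʳ x (- 1#) 1#))
      (≋-trans (⊙-cong (-‿inverseˡ 1#) ≋-refl) (⊙-zeroˡ x)))

  freeModule : Setoid b ℓb → LeftModule ring (c ⊔ b) (c ⊔ ℓ ⊔ b ⊔ ℓb)
  freeModule B = record
    { Carrierᴹ     = FreeModule B
    ; _≈ᴹ_         = _≋_
    ; _+ᴹ_         = _⊕_
    ; _*ₗ_         = _⊙_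
    ; 0ᴹ           = 𝟎
    ; -ᴹ_          = (- 1#) ⊙_
    ; isLeftModule = record
      { isLeftSemimodule = record
        { +ᴹ-isCommutativeMonoid = record
          { isMonoid = record
            { isSemigroup = record
              { isMagma = record
                { isEquivalence = record { refl = ≋-refl ; sym = ≋-sym ; trans = ≋-trans }
                ; ∙-cong        = ⊕-cong
                }
              ; assoc = ⊕-assoc
              }
            ; identity = ⊕-identityˡ , λ x → ≋-trans (⊕-comm x 𝟎) (⊕-identityˡ x)
            }
          ; comm = ⊕-comm
          }
        ; isPreleftSemimodule = record
          { *ₗ-cong      = ⊙-cong
          ; *ₗ-zeroˡ     = ⊙-zeroˡ
          ; *ₗ-distribʳ  = ⊙-distribʳ
          ; *ₗ-identityˡ = ⊙-identityˡ
          ; *ₗ-assoc     = ⊙-assoc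
          ; *ₗ-zeroʳ     = ⊙-zeroʳ
          ; *ₗ-distribˡ  = ⊙-distribˡ
          }
        }
      ; -ᴹ‿cong    = ⊙-cong refl
      ; -ᴹ‿inverse = ⊕-inverseˡ , λ x → ≋-trans (⊕-comm x _) (⊕-inverseˡ x)
      }
    }

  module _ {m ℓm} (M : LeftModule ring m ℓm) where
    open LeftModule M

    extend : {B : Setoid b ℓb} → (Setoid.Carrier B → Carrierᴹ) → FreeModule B → Carrierᴹ
    extend f (η i)   = f i
    extend f 𝟎       = 0ᴹ
    extend f (x ⊕ y) = extend f x +ᴹ extend f y
    extend f (r ⊙ x) = r *ₗ extend f x

  linearForm : {B : Setoid b ℓb} → (Setoid.Carrier B → Carrier) → FreeModule B → Carrier
  linearForm = extend (TensorUnit.leftModule {R = ring})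

  linearMap : {A : Setoid a ℓa} {B : Setoid b ℓb} →
              (Setoid.Carrier A → FreeModule B) → FreeModule A → FreeModule B
  linearMap {B = B} = extend (freeModule B)

  ∑ : {I : Set} {B : Setoid b ℓb} → List I → (I → FreeModule B) → FreeModule B
  ∑ is f = foldr (λ i x → f i ⊕ x) 𝟎 is

  -- The tensor product of the free modules on A and B is the free module
  -- on ×-setoid A B, with the following pure tensors.

  infixr 7 _⊠_

  _⊠_ : {A : Setoid a ℓa} {B : Setoid b ℓb} →
        FreeModule A → FreeModule B → FreeModule (×-setoid A B)
  x ⊠ y = linearMap (λ i → linearMap (λ j → η (i , j)) y) x

  _⊗_ : ∀ {a′ b′ ℓa′ ℓb′}
        {A : Setoid a ℓa} {B : Setoid b ℓb} {A′ : Setoid a′ ℓa′} {B′ : Setoid b′ ℓb′} →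
        (FreeModule A → FreeModule A′) → (FreeModule B → FreeModule B′) →
        FreeModule (×-setoid A B) → FreeModule (×-setoid A′ B′)
  f ⊗ g = linearMap λ (i , j) → f (η i) ⊠ g (η j)

  -- The tensor product of linear forms, composed with R ⊗ R ≅ R.

  _⊗ᶠ_ : {A : Setoid a ℓa} {B : Setoid b ℓb} →
         (FreeModule A → Carrier) → (FreeModule B → Carrier) →
         FreeModule (×-setoid A B) → Carrier
  f ⊗ᶠ g = linearForm λ (i , j) → f (η i) * g (η j)

  module MonoidAlgebra (M : CommutativeMonoid b ℓb) where
    open CommutativeMonoid M using (setoid; _∙_; ε)

    μ : FreeModule (×-setoid setoid setoid) → FreeModule setoid
    μ = linearMap λ (i , j) → η (i ∙ j)

    multiplicativeRawMonoid : RawMonoid _ _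
    multiplicativeRawMonoid = record
      { Carrier = FreeModule setoid
      ; _≈_     = _≋_
      ; _∙_     = λ x y → μ (x ⊠ y)
      ; ε       = η ε
      }

  -- The free commutative algebra on X is the free module on its monomials,
  -- i.e. on lists over X up to permutation.

  monomials : Setoid a ℓa → CommutativeMonoid a (a ⊔ ℓa)
  monomials = PermutationProperties.++-commutativeMonoid

  monomialSetoid : Setoid a ℓa → Setoid a (a ⊔ ℓa)
  monomialSetoid X = CommutativeMonoid.setoid (monomials X)

  multiplicative : {A : Set a} (N : RawMonoid b ℓb) →
                   (A → RawMonoid.Carrier N) → List A → RawMonoid.Carrier N
  multiplicative N f = foldr (λ x y → f x ∙ y) ε
    where open RawMonoid N

  -- Algebra morphisms out of the free commutative algebra, given on generators.

  character : (X : Setoid a ℓa) →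
              (Setoid.Carrier X → Carrier) → FreeModule (monomialSetoid X) → Carrier
  character X f = linearForm (multiplicative *-rawMonoid f)

  algebraMorphism : (X : Setoid a ℓa) (N : CommutativeMonoid b ℓb) →
                    (Setoid.Carrier X → FreeModule (CommutativeMonoid.setoid N)) →
                    FreeModule (monomialSetoid X) → FreeModule (CommutativeMonoid.setoid N)
  algebraMorphism X N f =
    linearMap (multiplicative (MonoidAlgebra.multiplicativeRawMonoid N) f)

  counit : (X : Setoid a ℓa) → FreeModule (monomialSetoid X) → Carrier
  counit X = linearForm λ { [] → 1# ; (_ ∷ _) → 0# }

module _ (k : HeytingField c ℓ₁ ℓ₂) where

  open HeytingField k using (_#_; 0#; 1#; heytingCommutativeRing)
  open HeytingCommutativeRing heytingCommutativeRing using (commutativeRing)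
  open RawSemiringDefinitions (Semiring.rawSemiring (CommutativeRing.semiring commutativeRing))
    using () renaming (_×_ to _×ₖ_)

  CharacteristicZero : Set ℓ₂
  CharacteristicZero = ∀ n → .⦃ NonZero n ⦄ → (n ×ₖ 1#) # 0#

module TreeHopfAlgebras (k : HeytingField c ℓ₁ ℓ₂) (char0 : CharacteristicZero k) where

  open HeytingField k public
    using (Carrier; _≈_; _+_; _*_; -_; _-_; 0#; 1#; heytingCommutativeRing; #⇒invertible)
  open HeytingCommutativeRing heytingCommutativeRing public using (commutativeRing)
  open RawSemiringDefinitions (Semiring.rawSemiring (CommutativeRing.semiring commutativeRing)) public
    using (_^_; sum)
  open Free commutativeRing public

  -- The inverse of n in k; #⇒invertible provides an inverse of (n × 1#) - 0#.

  1/ : ∀ n → .⦃ NonZero n ⦄ → Carrier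
  1/ n = proj₁ (#⇒invertible (char0 n))

  ℋ-monomials ℋCK-monomials : CommutativeMonoid 0ℓ 0ℓ
  ℋ-monomials   = monomials tree⁺Setoid
  ℋCK-monomials = monomials treeSetoid

  ℋ ℋCK ℋ⊗ℋ ℋ⊗ℋCK ℋCK⊗ℋCK : Set c
  ℋ       = FreeModule (monomialSetoid tree⁺Setoid)
  ℋCK     = FreeModule (monomialSetoid treeSetoid)
  ℋ⊗ℋ     = FreeModule (×-setoid (monomialSetoid tree⁺Setoid) (monomialSetoid tree⁺Setoid))
  ℋ⊗ℋCK   = FreeModule (×-setoid (monomialSetoid tree⁺Setoid) (monomialSetoid treeSetoid))
  ℋCK⊗ℋCK = FreeModule (×-setoid (monomialSetoid treeSetoid) (monomialSetoid treeSetoid))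

  Δ : ℋ → ℋ⊗ℋ
  Δ = algebraMorphism tree⁺Setoid (DirectProduct.commutativeMonoid ℋ-monomials ℋ-monomials)
    λ (t , _) → ∑ (subforests t) λ s → η (components s , tree→monomial (contract s))

  module ℋ-module = LeftModule (freeModule (monomialSetoid tree⁺Setoid))

  record IsAntipode (S : ℋ → ℋ) : Set (c ⊔ ℓ₁) where
    open LeftModuleMorphisms ℋ-module.rawLeftModule ℋ-module.rawLeftModule
    open MonoidAlgebra ℋ-monomials using (μ)
    field
      isLinear : IsLeftModuleHomomorphism S
      inverseˡ : ∀ x → μ ((S ⊗ id) (Δ x)) ≋ counit tree⁺Setoid x ⊙ η []
      inverseʳ : ∀ x → μ ((id ⊗ S) (Δ x)) ≋ counit tree⁺Setoid x ⊙ η []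

  E : ℋ → Carrier
  E = character tree⁺Setoid λ (t , _) → 1/ (t !) ⦃ !-nonZero t ⦄

  L : (S : ℋ → ℋ) → ℋ → Carrier
  L S = E ∘ S

  Φ : ℋCK → ℋ⊗ℋCK
  Φ = algebraMorphism treeSetoid (DirectProduct.commutativeMonoid ℋ-monomials ℋCK-monomials)
    λ t → ∑ (subforests t) λ s → η (components s , [ contract s ])

  infixr 7 _⋆_

  _⋆_ : (ℋ → Carrier) → (ℋCK → Carrier) → ℋCK → Carrier
  f ⋆ g = (f ⊗ᶠ g) ∘ Φ

  ΔCK : ℋCK → ℋCK⊗ℋCK
  ΔCK = linearMap λ u → ∑ (decompositions u) λ d → η (V-part d , W-part d)

  ε : ℋCK → Carrier
  ε = counit treeSetoid

  infixr 7 _∗_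
  infixr 8 _^∗_

  _∗_ : (ℋCK → Carrier) → (ℋCK → Carrier) → ℋCK → Carrier
  f ∗ g = (f ⊗ᶠ g) ∘ ΔCK

  _^∗_ : (ℋCK → Carrier) → ℕ → ℋCK → Carrier
  f ^∗ zero  = ε
  f ^∗ suc n = f ∗ (f ^∗ n)

  δ : ℋCK → Carrier
  δ = character treeSetoid λ { (B₊ []) → 1# ; (B₊ (_ ∷ _)) → 0# }

  δ• : ℋCK → Carrier
  δ• = linearForm λ { (B₊ [] ∷ []) → 1# ; _ → 0# }

  logTerm : (ℋCK → Carrier) → ∀ n → .⦃ NonZero n ⦄ → ℋCK → Carrier
  logTerm f n x = ((- 1#) ^ suc n * 1/ n) * ((λ y → f y - ε y) ^∗ n) x

  -- g is the sum over n ≥ 1 of the logTerm f n, as a locally finite sum: on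
  -- each x all but finitely many terms vanish, and the others add up to g x.

  _≈log∗_ : (g f : ℋCK → Carrier) → Set (c ⊔ ℓ₁)
  g ≈log∗ f = ∀ x → ∃[ N ]
    (∀ n → suc n > N → logTerm f (suc n) x ≈ 0#) ×
    g x ≈ sum {N} (λ i → logTerm f (suc (toℕ i)) x)

{-# OPTIONS --safe #-}
module Submission where

-- Let Ω n t be the strict order polynomial of t and Δ the forward difference in n.
-- Then δ^∗n = Ω n and (δ - ε)^∗n = Δⁿ Ω at 0, so that log∗ δ is the derivative of Ω at 0 by
-- Newton's formula.  Moreover E ⋆ Ω n = n^∣t∣ / t!, whose derivative at 0 is the
-- counit, while E ⋆ L is the counit because S is an antipode.  Since E ⋆ _ is
-- unitriangular with respect to the size of the contracted tree, it follows by
-- induction on ∣ t ∣ that Ω n t is a polynomial in n with derivative L t at 0.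
-- On forests with at least two trees Ω is a product of polynomials vanishing
-- at 0, so its derivative there vanishes too.

open import Defs
import Algebra.Construct.DirectProduct as DirectProduct
open import Algebra.Apartness.Bundles using (HeytingField)
open import Algebra.Bundles using (CommutativeRing; Semiring; CommutativeMonoid)
import Algebra.Definitions.RawSemiring as RawSemiringDefinitions
import Algebra.Properties.CommutativeSemigroup as CommutativeSemigroupProperties
import Algebra.Properties.Ring as RingProperties
import Algebra.Properties.Semiring.Mult as SemiringMult
import Algebra.Solver.Ring.NaturalCoefficients.Default as SemiringSolver
open import Data.Fin.Base using (toℕ)
open import Data.List.Base using (List; []; _∷_; [_]; _++_; map; foldr; cartesianProductWith)
import Data.List.Properties as List
open import Data.List.Relation.Binary.Permutation.Homogeneous as Homogeneous using (Permutation)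
open import Data.List.Relation.Binary.Pointwise.Base using (Pointwise; []; _∷_)
open import Data.Nat.Base as ℕ using (ℕ; zero; suc; z≤n; s≤s; NonZero)
import Data.Nat.Properties as ℕ
open import Data.Product.Base using (_×_; _,_; proj₁; proj₂; ∃-syntax)
open import Data.Sum.Base using (_⊎_; inj₁; inj₂)
open import Data.Unit.Base using (tt)
open import Function.Base using (_∘_; id)
open import Level using (Level; _⊔_)
open import Relation.Binary.Bundles using (Setoid)
open import Relation.Binary.PropositionalEquality as ≡ using (_≡_)
import Relation.Binary.Reasoning.Setoid as SetoidReasoning

-- The identity E ⋆ Ω n = n^∣t∣ / t! is a volume computation in disguise. 1 / t! is the volume of
-- the set of order-preserving maps from the vertices of t to the unit interval, so n^∣t∣ / t! is
-- that of the order-preserving maps to [0, n]. Up to measure zero, the edges whose two ends have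
-- the same integer part form a subforest s; the integer parts are a strict map on t / s, and the
-- fractional parts contribute `E` of s. Over a general field this is done algebraically, adding one
-- unit interval at a time. The obstacle is that an induction on t has to keep track of the
-- component through the root: if the added interval has length u, that component contributes a
-- power of u, and the factor 1 / size of the tree factorial is an integration in u. `umbral`
-- replaces u^j by arbitrary values g j, so that the induction hypothesis covers all linear forms on
-- polynomials in u at once.

private
  module +-Properties = CommutativeSemigroupProperties ℕ.+-commutativeSemigroup
  module *-Properties = CommutativeSemigroupProperties ℕ.*-commutativeSemigroup

  variable
    c ℓ : Level

-- Finite sums and umbral evaluation of powers of x + u

module RingSums (R : CommutativeRing c ℓ) where

  open CommutativeRing R hiding (zero)
  open RawSemiringDefinitions (Semiring.rawSemiring semiring) using (_^_; sum)
    renaming (_×_ to _×ᴿ_)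
  open RingProperties ring using (-0#≈0#; -‿distribʳ-*; -‿+-comm; -‿involutive; -1*x≈-x)
  open SemiringSolver commutativeSemiring using (solve; _:=_; _:+_; _:*_; con)
  open SetoidReasoning setoid

  ι : ℕ → Carrier
  ι n = n ×ᴿ 1#

  Σˡ : {I : Set} → List I → (I → Carrier) → Carrier
  Σˡ is f = foldr (λ i x → f i + x) 0# is

  module _ {I : Set} where

    Σˡ-cong : ∀ (is : List I) {f g} → (∀ i → f i ≈ g i) → Σˡ is f ≈ Σˡ is g
    Σˡ-cong []       f≈g = refl
    Σˡ-cong (i ∷ is) f≈g = +-cong (f≈g i) (Σˡ-cong is f≈g)

    Σˡ-++ : ∀ (is js : List I) f → Σˡ (is ++ js) f ≈ Σˡ is f + Σˡ js f
    Σˡ-++ []       js f = sym (+-identityˡ _)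
    Σˡ-++ (i ∷ is) js f = trans (+-congˡ (Σˡ-++ is js f)) (sym (+-assoc _ _ _))

    Σˡ-map : ∀ {J : Set} (h : J → I) js f → Σˡ (map h js) f ≈ Σˡ js (f ∘ h)
    Σˡ-map h []       f = refl
    Σˡ-map h (j ∷ js) f = +-congˡ (Σˡ-map h js f)

    Σˡ-zero : ∀ (is : List I) {f} → (∀ i → f i ≈ 0#) → Σˡ is f ≈ 0#
    Σˡ-zero []       f≈0 = refl
    Σˡ-zero (i ∷ is) f≈0 = trans (+-cong (f≈0 i) (Σˡ-zero is f≈0)) (+-identityˡ 0#)

    Σˡ-+ : ∀ (is : List I) f g → Σˡ is (λ i → f i + g i) ≈ Σˡ is f + Σˡ is g
    Σˡ-+ []       f g = sym (+-identityˡ 0#)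
    Σˡ-+ (i ∷ is) f g = trans (+-congˡ (Σˡ-+ is f g))
      (solve 4 (λ a b x y → (a :+ b) :+ (x :+ y) := (a :+ x) :+ (b :+ y)) refl _ _ _ _)

    Σˡ-*ˡ : ∀ (is : List I) a f → Σˡ is (λ i → a * f i) ≈ a * Σˡ is f
    Σˡ-*ˡ []       a f = sym (zeroʳ a)
    Σˡ-*ˡ (i ∷ is) a f = trans (+-congˡ (Σˡ-*ˡ is a f)) (sym (distribˡ a _ _))

    Σˡ-*ʳ : ∀ (is : List I) f a → Σˡ is (λ i → f i * a) ≈ Σˡ is f * a
    Σˡ-*ʳ is f a = trans (Σˡ-cong is λ i → *-comm (f i) a)
                   (trans (Σˡ-*ˡ is a f) (*-comm a _))

  module _ {I J : Set} where

    Σˡ-cartesianProductWith : ∀ {K : Set} (h : I → J → K) is js f →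
      Σˡ (cartesianProductWith h is js) f ≈ Σˡ is λ i → Σˡ js λ j → f (h i j)
    Σˡ-cartesianProductWith h []       js f = refl
    Σˡ-cartesianProductWith h (i ∷ is) js f =
      trans (Σˡ-++ (map (h i) js) _ f)
            (+-cong (Σˡ-map (h i) js f) (Σˡ-cartesianProductWith h is js f))

    Σˡ-* : ∀ (is : List I) (js : List J) f g →
      Σˡ is (λ i → Σˡ js λ j → f i * g j) ≈ Σˡ is f * Σˡ js g
    Σˡ-* is js f g = trans (Σˡ-cong is λ i → Σˡ-*ˡ js (f i) g) (Σˡ-*ʳ is f _)

  -- umbral x M g is (x + u)^M evaluated by the linear form u^j ↦ g j.

  umbral : Carrier → ℕ → (ℕ → Carrier) → Carrier
  umbral x zero    g = g 0
  umbral x (suc M) g = x * umbral x M g + umbral x M (g ∘ suc)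

  umbral-cong : ∀ x M {g h} → (∀ j → g j ≈ h j) → umbral x M g ≈ umbral x M h
  umbral-cong x zero    g≈h = g≈h 0
  umbral-cong x (suc M) g≈h =
    +-cong (*-congˡ (umbral-cong x M g≈h)) (umbral-cong x M (g≈h ∘ suc))

  umbral-+ : ∀ x M g h → umbral x M (λ j → g j + h j) ≈ umbral x M g + umbral x M h
  umbral-+ x zero    g h = refl
  umbral-+ x (suc M) g h =
    trans (+-cong (*-congˡ (umbral-+ x M g h)) (umbral-+ x M (g ∘ suc) (h ∘ suc)))
    (solve 5 (λ x a b c d → x :* (a :+ b) :+ (c :+ d) := (x :* a :+ c) :+ (x :* b :+ d))
       refl x _ _ _ _)

  umbral-*ʳ : ∀ x M g a → umbral x M (λ j → g j * a) ≈ umbral x M g * a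
  umbral-*ʳ x zero    g a = refl
  umbral-*ʳ x (suc M) g a =
    trans (+-cong (*-congˡ (umbral-*ʳ x M g a)) (umbral-*ʳ x M (g ∘ suc) a))
    (solve 4 (λ x b c a → x :* (b :* a) :+ c :* a := (x :* b :+ c) :* a) refl x _ _ a)

  -- Expands (x + u)^M (x + u)^N one factor at a time: evaluating the second factor yields the
  -- linear form for the first. In this way the trees of a forest are treated one after another.
  umbral-add : ∀ x M N g → umbral x (M ℕ.+ N) g ≈ umbral x M (λ j → umbral x N (λ i → g (j ℕ.+ i)))
  umbral-add x zero    N g = refl
  umbral-add x (suc M) N g = +-cong (*-congˡ (umbral-add x M N g)) (umbral-add x M N (g ∘ suc))

  umbral-1 : ∀ x M → umbral x M (λ _ → 1#) ≈ (1# + x) ^ M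
  umbral-1 x zero    = refl
  umbral-1 x (suc M) =
    trans (+-cong (*-congˡ (umbral-1 x M)) (umbral-1 x M))
    (solve 2 (λ x a → x :* a :+ a := (con 1 :+ x) :* a) refl x _)

  -- (x + u)^(M+1) = x^(M+1) + (M+1) ∫₀ᵘ (x + v)^M dv, where u^(m+1) = (m+1) ∫₀ᵘ v^m dv.

  umbral-integral : ∀ x M g h → (∀ m → g (suc m) ≈ ι (suc m) * h m) →
    umbral x (suc M) g ≈ x ^ suc M * g 0 + ι (suc M) * umbral x M h
  umbral-integral x zero    g h g≈ =
    +-cong (*-congʳ (sym (*-identityʳ x))) (g≈ 0)
  umbral-integral x (suc M) g h g≈ = begin
    x * umbral x (suc M) g + umbral x (suc M) (g ∘ suc)
      ≈⟨ +-cong (*-congˡ (umbral-integral x M g h g≈))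
                (trans (umbral-cong x (suc M) split) (umbral-+ x (suc M) h (λ m → ι m * h m))) ⟩
    x * (x ^ suc M * g 0 + ι (suc M) * umbral x M h)
      + (umbral x (suc M) h + umbral x (suc M) (λ m → ι m * h m))
      ≈⟨ +-congˡ (+-congˡ (umbral-integral x M (λ m → ι m * h m) (h ∘ suc) (λ _ → refl))) ⟩
    x * (x ^ suc M * g 0 + ι (suc M) * umbral x M h)
      + (umbral x (suc M) h
         + (x ^ suc M * (0# * h 0) + ι (suc M) * umbral x M (h ∘ suc)))
      ≈⟨ solve 7 (λ x p a n b c z → x :* (p :* a :+ n :* b) :+ ((x :* b :+ c) :+ (p :* (con 0 :* z) :+ n :* c))
                   := x :* p :* a :+ (con 1 :+ n) :* (x :* b :+ c))
           refl x (x ^ suc M) (g 0) (ι (suc M)) (umbral x M h) (umbral x M (h ∘ suc)) (h 0) ⟩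
    x ^ suc (suc M) * g 0 + ι (suc (suc M)) * umbral x (suc M) h ∎
    where
    split : ∀ m → g (suc m) ≈ h m + ι m * h m
    split m = trans (g≈ m) (trans (distribʳ (h m) 1# (ι m)) (+-congʳ (*-identityˡ (h m))))

  -- Forward differences

  -- The new difference is taken innermost, to match `f ^∗ suc n`, whose new factor stands on the
  -- left and hence acts inside `diff n`.
  diff : ℕ → (ℕ → Carrier) → ℕ → Carrier
  diff zero    f = f
  diff (suc n) f = diff n λ m → f (suc m) - f m

  diff-cong : ∀ n {f g} → (∀ m → f m ≈ g m) → ∀ m → diff n f m ≈ diff n g m
  diff-cong zero    f≈g = f≈g
  diff-cong (suc n) f≈g = diff-cong n λ m → +-cong (f≈g (suc m)) (-‿cong (f≈g m))

  diff-+ : ∀ n f g m → diff n (λ i → f i + g i) m ≈ diff n f m + diff n g m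
  diff-+ zero    f g m = refl
  diff-+ (suc n) f g m = trans (diff-cong n interchange m) (diff-+ n _ _ m)
    where
    interchange : ∀ i → (f (suc i) + g (suc i)) - (f i + g i) ≈ (f (suc i) - f i) + (g (suc i) - g i)
    interchange i = trans (+-congˡ (sym (-‿+-comm (f i) (g i))))
      (solve 4 (λ a b x y → (a :+ b) :+ (x :+ y) := (a :+ x) :+ (b :+ y)) refl _ _ _ _)

  diff-*ˡ : ∀ n a f m → diff n (λ i → a * f i) m ≈ a * diff n f m
  diff-*ˡ zero    a f m = refl
  diff-*ˡ (suc n) a f m = trans (diff-cong n factor m) (diff-*ˡ n a _ m)
    where
    factor : ∀ i → a * f (suc i) - a * f i ≈ a * (f (suc i) - f i)
    factor i = sym (trans (distribˡ a _ _) (+-congˡ (sym (-‿distribʳ-* a (f i)))))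

  diff-0 : ∀ n {f} → (∀ m → f m ≈ 0#) → ∀ m → diff n f m ≈ 0#
  diff-0 zero    f≈0 = f≈0
  diff-0 (suc n) f≈0 = diff-0 n λ m → trans (+-cong (f≈0 (suc m)) (-‿cong (f≈0 m))) (-‿inverseʳ 0#)

  diff-const : ∀ n a m → diff (suc n) (λ _ → a) m ≈ 0#
  diff-const n a = diff-0 n λ _ → -‿inverseʳ a

  diff-Σˡ : ∀ {I : Set} n (is : List I) (a : I → Carrier) (f : I → ℕ → Carrier) m →
    diff n (λ j → Σˡ is (λ i → a i * f i j)) m ≈ Σˡ is (λ i → a i * diff n (f i) m)
  diff-Σˡ n []       a f m = diff-0 n (λ _ → refl) m
  diff-Σˡ n (i ∷ is) a f m =
    trans (diff-+ n _ _ m) (+-cong (diff-*ˡ n (a i) (f i) m) (diff-Σˡ n is a f m))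

  diff-suc : ∀ n f m → diff n (f ∘ suc) m ≡ diff n f (suc m)
  diff-suc zero    f m = ≡.refl
  diff-suc (suc n) f m = diff-suc n (λ i → f (suc i) - f i) m

  diff-step : ∀ n f m → diff n f (suc m) ≈ diff n f m + diff (suc n) f m
  diff-step n f m = begin
    diff n f (suc m)                          ≡⟨ diff-suc n f m ⟨
    diff n (f ∘ suc) m                        ≈⟨ diff-cong n (λ i → x≈y+[x-y] (f (suc i)) (f i)) m ⟩
    diff n (λ i → f i + (f (suc i) - f i)) m  ≈⟨ diff-+ n f _ m ⟩
    diff n f m + diff (suc n) f m             ∎
    where
    x≈y+[x-y] : ∀ x y → x ≈ y + (x - y)
    x≈y+[x-y] x y = sym (begin
      y + (x - y)   ≈⟨ solve 3 (λ x y z → y :+ (x :+ z) := x :+ (y :+ z)) refl x y (- y) ⟩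
      x + (y - y)   ≈⟨ +-congˡ (-‿inverseʳ y) ⟩
      x + 0#        ≈⟨ +-identityʳ x ⟩
      x             ∎)

  -- One difference turns i g(i) into i Δg(i) + g(i + 1). Each further difference of the first
  -- summand releases one more copy of the term in g(i + 1), whence the factor n + 1.
  diff-leibniz : ∀ n g m → diff (suc n) (λ i → ι i * g i) m
                           ≈ ι m * diff (suc n) g m + ι (suc n) * diff n g (suc m)
  diff-leibniz n g m = trans (diff-cong n first m) (trans (diff-+ n _ _ m) (rest n))
    where
    Δg : ℕ → Carrier
    Δg i = g (suc i) - g i

    first : ∀ i → ι (suc i) * g (suc i) - ι i * g i ≈ ι i * Δg i + g (suc i)
    first i = trans (+-congˡ (-‿distribʳ-* (ι i) (g i)))
      (solve 3 (λ n x y → (con 1 :+ n) :* x :+ n :* y := n :* (x :+ y) :+ x)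
        refl (ι i) (g (suc i)) (- g i))

    rest : ∀ n → diff n (λ i → ι i * Δg i) m + diff n (g ∘ suc) m
                 ≈ ι m * diff n Δg m + ι (suc n) * diff n g (suc m)
    rest zero    = +-congˡ (sym (trans (*-congʳ (+-identityʳ 1#)) (*-identityˡ _)))
    rest (suc n) = trans (+-cong (diff-leibniz n Δg m) (reflexive (diff-suc (suc n) g m)))
      (solve 3 (λ a n b → (a :+ n :* b) :+ b := a :+ (con 1 :+ n) :* b)
        refl (ι m * diff (suc n) Δg m) (ι (suc n)) (diff n Δg (suc m)))

  -- Polynomial functions on the natural numbers and their derivative at 0

  -- Horner form suits functions such as `Ω`, known only by their values at natural numbers: a layer
  -- a + n g(n) is exactly what `diff-leibniz` handles.
  data Polynomial (f : ℕ → Carrier) : Set (c ⊔ ℓ) where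
    null   : (∀ n → f n ≈ 0#) → Polynomial f
    horner : ∀ a {g} → Polynomial g → (∀ n → f n ≈ a + ι n * g n) → Polynomial f

  polynomial-cong : ∀ {f g} → (∀ n → f n ≈ g n) → Polynomial f → Polynomial g
  polynomial-cong f≈g (null f≈0)       = null λ n → trans (sym (f≈g n)) (f≈0 n)
  polynomial-cong f≈g (horner a p f≈h) = horner a p λ n → trans (sym (f≈g n)) (f≈h n)

  polynomial-const : ∀ a → Polynomial (λ _ → a)
  polynomial-const a = horner a (null λ _ → refl) λ n →
    sym (trans (+-congˡ (zeroʳ (ι n))) (+-identityʳ a))

  polynomial-ι* : ∀ {f} → Polynomial f → Polynomial (λ n → ι n * f n)
  polynomial-ι* p = horner 0# p λ n → sym (+-identityˡ _)

  polynomial-+ : ∀ {f g} → Polynomial f → Polynomial g → Polynomial (λ n → f n + g n)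
  polynomial-+ (null f≈0) q =
    polynomial-cong (λ n → sym (trans (+-congʳ (f≈0 n)) (+-identityˡ _))) q
  polynomial-+ p@(horner _ _ _) (null g≈0) =
    polynomial-cong (λ n → sym (trans (+-congˡ (g≈0 n)) (+-identityʳ _))) p
  polynomial-+ (horner a p f≈) (horner b q g≈) = horner (a + b) (polynomial-+ p q) λ n →
    trans (+-cong (f≈ n) (g≈ n))
    (solve 5 (λ n a x b y → (a :+ n :* x) :+ (b :+ n :* y) := (a :+ b) :+ n :* (x :+ y))
      refl (ι n) a _ b _)

  polynomial-*ˡ : ∀ a {f} → Polynomial f → Polynomial (λ n → a * f n)
  polynomial-*ˡ a (null f≈0)      = null λ n → trans (*-congˡ (f≈0 n)) (zeroʳ a)
  polynomial-*ˡ a (horner b p f≈) = horner (a * b) (polynomial-*ˡ a p) λ n →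
    trans (*-congˡ (f≈ n))
    (solve 4 (λ n a b x → a :* (b :+ n :* x) := a :* b :+ n :* (a :* x)) refl (ι n) a b _)

  polynomial-* : ∀ {f g} → Polynomial f → Polynomial g → Polynomial (λ n → f n * g n)
  polynomial-* (null f≈0)      q = null λ n → trans (*-congʳ (f≈0 n)) (zeroˡ _)
  polynomial-* (horner a p f≈) q =
    polynomial-cong (λ n → sym (trans (*-congʳ (f≈ n))
      (solve 4 (λ n a x y → (a :+ n :* x) :* y := a :* y :+ n :* (x :* y)) refl (ι n) a _ _)))
    (polynomial-+ (polynomial-*ˡ a q) (polynomial-ι* (polynomial-* p q)))

  polynomial-ι^ : ∀ M → Polynomial (λ n → ι n ^ M)
  polynomial-ι^ zero    = polynomial-const 1#
  polynomial-ι^ (suc M) = polynomial-ι* (polynomial-ι^ M)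

  -- The bound is the number of `horner` layers, since multiplication by n raises by one the order
  -- from which differences vanish.
  polynomial-diff : ∀ {f} → Polynomial f → ∃[ N ] ∀ n → N ℕ.≤ n → ∀ m → diff n f m ≈ 0#
  polynomial-diff (null f≈0) = 0 , λ n _ → diff-0 n f≈0
  polynomial-diff {f} (horner a {g} p f≈) with polynomial-diff p
  ... | N , vanish = suc N , λ { (suc n) (s≤s N≤n) m → begin
    diff (suc n) f m
      ≈⟨ diff-cong (suc n) f≈ m ⟩
    diff (suc n) (λ i → a + ι i * g i) m
      ≈⟨ diff-+ (suc n) (λ _ → a) (λ i → ι i * g i) m ⟩
    diff (suc n) (λ _ → a) m + diff (suc n) (λ i → ι i * g i) m
      ≈⟨ +-cong (diff-const n a m) (diff-leibniz n g m) ⟩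
    0# + (ι m * diff (suc n) g m + ι (suc n) * diff n g (suc m))
      ≈⟨ +-congˡ (+-cong (*-congˡ (vanish (suc n) (ℕ.m≤n⇒m≤1+n N≤n) m))
                         (*-congˡ (vanish n N≤n (suc m)))) ⟩
    0# + (ι m * 0# + ι (suc n) * 0#)
      ≈⟨ solve 2 (λ a b → con 0 :+ (a :* con 0 :+ b :* con 0) := con 0) refl (ι m) (ι (suc n)) ⟩
    0# ∎ }

  -- f is a polynomial function vanishing at 0, with derivative v there.

  HasDerivative : (ℕ → Carrier) → Carrier → Set (c ⊔ ℓ)
  HasDerivative f v = ∃[ q ] Polynomial q × q 0 ≈ v × (∀ n → f n ≈ ι n * q n)

  hasDerivative-cong : ∀ {f g v w} → (∀ n → f n ≈ g n) → v ≈ w →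
                       HasDerivative f v → HasDerivative g w
  hasDerivative-cong f≈g v≈w (q , p , q0 , f≈) =
    q , p , trans q0 v≈w , λ n → trans (sym (f≈g n)) (f≈ n)

  hasDerivative-0 : HasDerivative (λ _ → 0#) 0#
  hasDerivative-0 = (λ _ → 0#) , null (λ _ → refl) , refl , λ n → sym (zeroʳ (ι n))

  hasDerivative-+ : ∀ {f g v w} → HasDerivative f v → HasDerivative g w →
                    HasDerivative (λ n → f n + g n) (v + w)
  hasDerivative-+ (q , p , q0 , f≈) (r , p′ , r0 , g≈) =
    (λ n → q n + r n) , polynomial-+ p p′ , +-cong q0 r0 ,
    λ n → trans (+-cong (f≈ n) (g≈ n)) (sym (distribˡ (ι n) _ _))

  hasDerivative-*ˡ : ∀ a {f v} → HasDerivative f v → HasDerivative (λ n → a * f n) (a * v)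
  hasDerivative-*ˡ a (q , p , q0 , f≈) =
    (λ n → a * q n) , polynomial-*ˡ a p , *-congˡ q0 ,
    λ n → trans (*-congˡ (f≈ n)) (solve 3 (λ n a x → a :* (n :* x) := n :* (a :* x)) refl (ι n) a _)

  hasDerivative-Σˡ : ∀ {I : Set} (is : List I) {f : I → ℕ → Carrier} {v : I → Carrier} →
    (∀ i → HasDerivative (f i) (v i)) →
    HasDerivative (λ n → Σˡ is λ i → f i n) (Σˡ is v)
  hasDerivative-Σˡ []       h = hasDerivative-0
  hasDerivative-Σˡ (i ∷ is) h = hasDerivative-+ (h i) (hasDerivative-Σˡ is h)

  hasDerivative⇒polynomial : ∀ {f v} → HasDerivative f v → Polynomial f
  hasDerivative⇒polynomial (q , p , q0 , f≈) = polynomial-cong (λ n → sym (f≈ n)) (polynomial-ι* p)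

  -- The factor n of f serves for the whole product, leaving the cofactor q g. If g vanishes at 0,
  -- so does the derivative; this settles forests with several trees.
  hasDerivative-*ʳ : ∀ {f g v} → HasDerivative f v → Polynomial g →
                     HasDerivative (λ n → f n * g n) (v * g 0)
  hasDerivative-*ʳ {g = g} (q , p , q0 , f≈) p′ =
    (λ n → q n * g n) , polynomial-* p p′ , *-congʳ q0 ,
    λ n → trans (*-congʳ (f≈ n)) (*-assoc (ι n) (q n) (g n))

  -- Locally finite sums and Newton's formula

  -- Index shift: in the applications `a n` is the term of index n + 1 of a series over n ≥ 1.
  IsSumOf : Carrier → (ℕ → Carrier) → Set ℓ
  IsSumOf v a = ∃[ N ] (∀ n → N ℕ.≤ n → a n ≈ 0#) × v ≈ sum {N} (a ∘ toℕ)

  sum-cong : ∀ N {a b} → (∀ n → a n ≈ b n) → sum {N} (a ∘ toℕ) ≈ sum {N} (b ∘ toℕ)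
  sum-cong zero    a≈b = refl
  sum-cong (suc N) a≈b = +-cong (a≈b 0) (sum-cong N (a≈b ∘ suc))

  sum-+ : ∀ N a b → sum {N} ((λ n → a n + b n) ∘ toℕ) ≈ sum {N} (a ∘ toℕ) + sum {N} (b ∘ toℕ)
  sum-+ zero    a b = sym (+-identityˡ 0#)
  sum-+ (suc N) a b = trans (+-congˡ (sum-+ N (a ∘ suc) (b ∘ suc)))
    (solve 4 (λ a b x y → (a :+ b) :+ (x :+ y) := (a :+ x) :+ (b :+ y)) refl (a 0) (b 0) _ _)

  sum-*ˡ : ∀ N r a → sum {N} ((λ n → r * a n) ∘ toℕ) ≈ r * sum {N} (a ∘ toℕ)
  sum-*ˡ zero    r a = sym (zeroʳ r)
  sum-*ˡ (suc N) r a = trans (+-congˡ (sum-*ˡ N r (a ∘ suc))) (sym (distribˡ r (a 0) _))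

  sum-telescope : ∀ N (b : ℕ → Carrier) → sum {N} ((λ n → b n - b (suc n)) ∘ toℕ) ≈ b 0 - b N
  sum-telescope zero    b = sym (-‿inverseʳ (b 0))
  sum-telescope (suc N) b = trans (+-congˡ (sum-telescope N (b ∘ suc)))
    (trans (solve 4 (λ x y z w → (x :+ y) :+ (z :+ w) := x :+ w :+ (z :+ y)) refl
             (b 0) (- b 1) (b 1) (- b (suc N)))
    (trans (+-congˡ (-‿inverseʳ (b 1))) (+-identityʳ _)))

  sum-stable : ∀ N M (a : ℕ → Carrier) → (∀ n → N ℕ.≤ n → a n ≈ 0#) →
               sum {N ℕ.+ M} (a ∘ toℕ) ≈ sum {N} (a ∘ toℕ)
  sum-stable zero    zero    a vanish = refl
  sum-stable zero    (suc M) a vanish =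
    trans (+-cong (vanish 0 z≤n) (sum-stable zero M (a ∘ suc) (λ n _ → vanish (suc n) z≤n)))
          (+-identityˡ 0#)
  sum-stable (suc N) M       a vanish =
    +-congˡ (sum-stable N M (a ∘ suc) (λ n N≤n → vanish (suc n) (s≤s N≤n)))

  isSumOf-cong : ∀ {v w a b} → v ≈ w → (∀ n → a n ≈ b n) → IsSumOf v a → IsSumOf w b
  isSumOf-cong v≈w a≈b (N , vanish , v≈) =
    N , (λ n N≤n → trans (sym (a≈b n)) (vanish n N≤n)) ,
    trans (sym v≈w) (trans v≈ (sum-cong N a≈b))

  isSumOf-0 : ∀ {a} → (∀ n → a n ≈ 0#) → IsSumOf 0# a
  isSumOf-0 a≈0 = 0 , (λ n _ → a≈0 n) , refl

  isSumOf-+ : ∀ {v w a b} → IsSumOf v a → IsSumOf w b → IsSumOf (v + w) (λ n → a n + b n)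
  isSumOf-+ {a = a} {b} (N , a0 , v≈) (M , b0 , w≈) =
    N ℕ.+ M ,
    (λ n N+M≤n → trans (+-cong (a0 n (ℕ.m+n≤o⇒m≤o N N+M≤n)) (b0 n (ℕ.m+n≤o⇒n≤o N N+M≤n)))
                       (+-identityˡ 0#)) ,
    trans (+-cong
      (trans v≈ (sym (sum-stable N M a a0)))
      (trans w≈ (trans (sym (sum-stable M N b b0)) (reflexive (≡.cong (λ K → sum {K} (b ∘ toℕ)) (ℕ.+-comm M N))))))
    (sym (sum-+ (N ℕ.+ M) a b))

  isSumOf-*ˡ : ∀ r {v a} → IsSumOf v a → IsSumOf (r * v) (λ n → r * a n)
  isSumOf-*ˡ r {a = a} (N , a0 , v≈) =
    N , (λ n N≤n → trans (*-congˡ (a0 n N≤n)) (zeroʳ r)) ,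
    trans (*-congˡ v≈) (sym (sum-*ˡ N r a))

  -- Newton's formula log (1 + Δ) = d/dx at x = 0.  By the Leibniz rule
  -- Δⁿ⁺¹(x q)(0) = (n + 1)(Δⁿq(0) + Δⁿ⁺¹q(0)), so that the series telescopes.

  newton : ∀ (r : ℕ → Carrier) → (∀ n → r n * ι (suc n) ≈ 1#) → ∀ {f v} → HasDerivative f v →
    IsSumOf v (λ n → ((- 1#) ^ suc (suc n) * r n) * diff (suc n) f 0)
  newton r r-inverse {f} (q , p , q0 , f≈) with polynomial-diff p
  ... | N , vanish = isSumOf-cong q0 (λ n → sym (term n))
    (N , (λ n N≤n → trans (+-cong (b-vanish n N≤n) (-‿cong (b-vanish (suc n) (ℕ.m≤n⇒m≤1+n N≤n))))
                           (-‿inverseʳ 0#)) ,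
     sym (begin
       sum {N} ((λ n → b n - b (suc n)) ∘ toℕ)  ≈⟨ sum-telescope N b ⟩
       b 0 - b N                                ≈⟨ +-cong (*-identityˡ (q 0)) (-‿cong (b-vanish N ℕ.≤-refl)) ⟩
       q 0 - 0#                                 ≈⟨ +-congˡ -0#≈0# ⟩
       q 0 + 0#                                 ≈⟨ +-identityʳ (q 0) ⟩
       q 0                                      ∎))
    where
    b : ℕ → Carrier
    b n = (- 1#) ^ n * diff n q 0

    b-vanish : ∀ n → N ℕ.≤ n → b n ≈ 0#
    b-vanish n N≤n = trans (*-congˡ (vanish n N≤n 0)) (zeroʳ _)

    term : ∀ n → ((- 1#) ^ suc (suc n) * r n) * diff (suc n) f 0 ≈ b n - b (suc n)
    term n = begin
      -- The exponent n + 2 is that of the logarithm's term of index n + 1; two of the signs cancel,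
      -- leaving that of `b n`.
      (s * (s * sⁿ) * r n) * diff (suc n) f 0
        ≈⟨ *-congˡ (trans (diff-cong (suc n) f≈ 0) (trans (diff-leibniz n q 0) (+-congˡ (*-congˡ (diff-step n q 0))))) ⟩
      (s * (s * sⁿ) * r n) * (0# * Δ₁ + ι (suc n) * (Δ₀ + Δ₁))
        ≈⟨ solve 6 (λ s sⁿ r i x y → (s :* (s :* sⁿ) :* r) :* (con 0 :* y :+ i :* (x :+ y))
                      := (r :* i) :* ((s :* s) :* (sⁿ :* x) :+ s :* (s :* sⁿ :* y)))
             refl s sⁿ (r n) (ι (suc n)) Δ₀ Δ₁ ⟩
      (r n * ι (suc n)) * ((s * s) * (sⁿ * Δ₀) + s * b (suc n))
        ≈⟨ *-cong (r-inverse n) (+-cong (*-congʳ s*s≈1) (-1*x≈-x _)) ⟩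
      1# * (1# * b n - b (suc n))
        ≈⟨ trans (*-identityˡ _) (+-congʳ (*-identityˡ _)) ⟩
      b n - b (suc n) ∎
      where
      s sⁿ Δ₀ Δ₁ : Carrier
      s  = - 1#
      sⁿ = s ^ n
      Δ₀ = diff n q 0
      Δ₁ = diff (suc n) q 0

      s*s≈1 : s * s ≈ 1#
      s*s≈1 = trans (-1*x≈-x s) (-‿involutive 1#)

-- Linear forms on free modules and monoid algebras

module FreeModuleProperties (R : CommutativeRing c ℓ) where

  open CommutativeRing R
  open Free R
  open RingSums R using (Σˡ)
  open SemiringSolver commutativeSemiring using (solve; _:=_; _:+_; _:*_)

  module _ {b ℓb} {B : Setoid b ℓb} where

    linearForm-cong : ∀ {f} → (∀ {i j} → Setoid._≈_ B i j → f i ≈ f j) →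
                      ∀ {x y : FreeModule B} → x ≋ y → linearForm f x ≈ linearForm f y
    linearForm-cong {f} f-cong = go
      where
      go : ∀ {x y : FreeModule B} → x ≋ y → linearForm f x ≈ linearForm f y
      go ≋-refl              = refl
      go (≋-sym p)           = sym (go p)
      go (≋-trans p q)       = trans (go p) (go q)
      go (η-cong p)          = f-cong p
      go (⊕-cong p q)        = +-cong (go p) (go q)
      go (⊕-assoc x y z)     = +-assoc _ _ _
      go (⊕-comm x y)        = +-comm _ _
      go (⊕-identityˡ x)     = +-identityˡ _
      go (⊙-cong r p)        = *-cong r (go p)
      go (⊙-zeroˡ x)         = zeroˡ _
      go (⊙-zeroʳ r)         = zeroʳ r
      go (⊙-distribʳ x r s)  = distribʳ _ r s
      go (⊙-distribˡ r x y)  = distribˡ r _ _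
      go (⊙-assoc r s x)     = *-assoc r s _
      go (⊙-identityˡ x)     = *-identityˡ _

    linearForm-ext : ∀ {f g} → (∀ i → f i ≈ g i) →
                     ∀ (x : FreeModule B) → linearForm f x ≈ linearForm g x
    linearForm-ext f≈g (η i)   = f≈g i
    linearForm-ext f≈g 𝟎       = refl
    linearForm-ext f≈g (x ⊕ y) = +-cong (linearForm-ext f≈g x) (linearForm-ext f≈g y)
    linearForm-ext f≈g (r ⊙ x) = *-congˡ (linearForm-ext f≈g x)

    linearForm-0 : ∀ {f} → (∀ i → f i ≈ 0#) → ∀ (x : FreeModule B) → linearForm f x ≈ 0#
    linearForm-0 f≈0 (η i)   = f≈0 i
    linearForm-0 f≈0 𝟎       = refl
    linearForm-0 f≈0 (x ⊕ y) = trans (+-cong (linearForm-0 f≈0 x) (linearForm-0 f≈0 y)) (+-identityˡ 0#)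
    linearForm-0 f≈0 (r ⊙ x) = trans (*-congˡ (linearForm-0 f≈0 x)) (zeroʳ r)

    linearForm-∑ : ∀ {I : Set} f (is : List I) (h : I → FreeModule B) →
                   linearForm f (∑ is h) ≡ Σˡ is (linearForm f ∘ h)
    linearForm-∑ f []       h = ≡.refl
    linearForm-∑ f (i ∷ is) h = ≡.cong (linearForm f (h i) +_) (linearForm-∑ f is h)

    linearForm-*ʳ : ∀ f a (x : FreeModule B) → linearForm (λ i → f i * a) x ≈ linearForm f x * a
    linearForm-*ʳ f a (η i)   = refl
    linearForm-*ʳ f a 𝟎       = sym (zeroˡ a)
    linearForm-*ʳ f a (x ⊕ y) =
      trans (+-cong (linearForm-*ʳ f a x) (linearForm-*ʳ f a y)) (sym (distribʳ a _ _))
    linearForm-*ʳ f a (r ⊙ x) = trans (*-congˡ (linearForm-*ʳ f a x)) (sym (*-assoc r _ a))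

    linearForm-*ˡ : ∀ a f (x : FreeModule B) → linearForm (λ i → a * f i) x ≈ a * linearForm f x
    linearForm-*ˡ a f x = trans (linearForm-ext (λ i → *-comm a (f i)) x)
                          (trans (linearForm-*ʳ f a x) (*-comm _ a))

    linearForm-linearMap : ∀ {a ℓa} {A : Setoid a ℓa} f (h : Setoid.Carrier A → FreeModule B) x →
      linearForm f (linearMap {A = A} h x) ≡ linearForm (linearForm f ∘ h) x
    linearForm-linearMap f h (η i)   = ≡.refl
    linearForm-linearMap f h 𝟎       = ≡.refl
    linearForm-linearMap f h (x ⊕ y) =
      ≡.cong₂ _+_ (linearForm-linearMap f h x) (linearForm-linearMap f h y)
    linearForm-linearMap f h (r ⊙ x) = ≡.cong (r *_) (linearForm-linearMap f h x)

  linearForm-⊠ : ∀ {a ℓa b ℓb} {A : Setoid a ℓa} {B : Setoid b ℓb}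
    f (x : FreeModule A) (y : FreeModule B) →
    linearForm f (x ⊠ y) ≈ linearForm (λ i → linearForm (λ j → f (i , j)) y) x
  linearForm-⊠ f x y = trans (reflexive (linearForm-linearMap f _ x))
    (linearForm-ext (λ i → reflexive (linearForm-linearMap f _ y)) x)

  module _ {b ℓb} (M : CommutativeMonoid b ℓb) where

    open CommutativeMonoid M using (_∙_) renaming (setoid to B)
    open MonoidAlgebra M using (μ)

    linearForm-μ : ∀ f (x y : FreeModule B) →
      linearForm f (μ (x ⊠ y)) ≈ linearForm (λ i → linearForm (λ j → f (i ∙ j)) y) x
    linearForm-μ f x y = trans (reflexive (linearForm-linearMap f _ (x ⊠ y))) (linearForm-⊠ _ x y)

    linearForm-multiplicative : ∀ {f} → (∀ i j → f (i ∙ j) ≈ f i * f j) →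
      ∀ (x y : FreeModule B) → linearForm f (μ (x ⊠ y)) ≈ linearForm f x * linearForm f y
    linearForm-multiplicative {f} f-∙ x y =
      trans (linearForm-μ f x y)
      (trans (linearForm-ext (λ i → trans (linearForm-ext (f-∙ i) y) (linearForm-*ˡ (f i) f y)) x)
             (linearForm-*ʳ f _ x))

-- Isomorphism invariance of size and tree factorial

∣∣-cong : ∀ {t u} → t ≅ u → ∣ t ∣ ≡ ∣ u ∣
∣∣ᶠ-cong-≋ : ∀ {ts us} → Pointwise _≅_ ts us → ∣ ts ∣ᶠ ≡ ∣ us ∣ᶠ
∣∣ᶠ-cong : ∀ {ts us} → Permutation _≅_ ts us → ∣ ts ∣ᶠ ≡ ∣ us ∣ᶠ
∣∣-cong (B₊-cong p) = ≡.cong suc (∣∣ᶠ-cong p)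
∣∣ᶠ-cong-≋ []       = ≡.refl
∣∣ᶠ-cong-≋ (p ∷ ps) = ≡.cong₂ ℕ._+_ (∣∣-cong p) (∣∣ᶠ-cong-≋ ps)
∣∣ᶠ-cong (Homogeneous.refl ps)    = ∣∣ᶠ-cong-≋ ps
∣∣ᶠ-cong (Homogeneous.prep p q)   = ≡.cong₂ ℕ._+_ (∣∣-cong p) (∣∣ᶠ-cong q)
∣∣ᶠ-cong (Homogeneous.swap {xs} {ys} {x} {y} {x′} {y′} p q r)
  rewrite ∣∣-cong p | ∣∣-cong q | ∣∣ᶠ-cong r =
  +-Properties.x∙yz≈y∙xz (∣ x′ ∣) (∣ y′ ∣) (∣ ys ∣ᶠ)
∣∣ᶠ-cong (Homogeneous.trans p q)  = ≡.trans (∣∣ᶠ-cong p) (∣∣ᶠ-cong q)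

!-cong : ∀ {t u} → t ≅ u → t ! ≡ u !
!ᶠ-cong-≋ : ∀ {ts us} → Pointwise _≅_ ts us → ts !ᶠ ≡ us !ᶠ
!ᶠ-cong : ∀ {ts us} → Permutation _≅_ ts us → ts !ᶠ ≡ us !ᶠ
!-cong (B₊-cong p) = ≡.cong₂ ℕ._*_ (≡.cong suc (∣∣ᶠ-cong p)) (!ᶠ-cong p)
!ᶠ-cong-≋ []       = ≡.refl
!ᶠ-cong-≋ (p ∷ ps) = ≡.cong₂ ℕ._*_ (!-cong p) (!ᶠ-cong-≋ ps)
!ᶠ-cong (Homogeneous.refl ps)    = !ᶠ-cong-≋ ps
!ᶠ-cong (Homogeneous.prep p q)   = ≡.cong₂ ℕ._*_ (!-cong p) (!ᶠ-cong q)
!ᶠ-cong (Homogeneous.swap {xs} {ys} {x} {y} {x′} {y′} p q r)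
  rewrite !-cong p | !-cong q | !ᶠ-cong r =
  *-Properties.x∙yz≈y∙xz (x′ !) (y′ !) (ys !ᶠ)
!ᶠ-cong (Homogeneous.trans p q)  = ≡.trans (!ᶠ-cong p) (!ᶠ-cong q)

∣∣ᶠ-++ : ∀ ts us → ∣ ts ++ us ∣ᶠ ≡ ∣ ts ∣ᶠ ℕ.+ ∣ us ∣ᶠ
∣∣ᶠ-++ []       us = ≡.refl
∣∣ᶠ-++ (t ∷ ts) us = ≡.trans (≡.cong (∣ t ∣ ℕ.+_) (∣∣ᶠ-++ ts us)) (≡.sym (ℕ.+-assoc ∣ t ∣ _ _))

-- The two extreme subforests and the size of a contraction

trivialSubforest : ∀ t → Subforest t
trivialBranches : ∀ ts → Branches ts
trivialSubforest (B₊ ts) = join (trivialBranches ts)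
trivialBranches []       = []
trivialBranches (t ∷ ts) = omit (trivialSubforest t) (trivialBranches ts)

contract-trivial : ∀ t → contract (trivialSubforest t) ≡ t
contractBranches-trivial : ∀ ts → contractBranches (trivialBranches ts) ≡ ts
contract-trivial (B₊ ts) = ≡.cong B₊ (contractBranches-trivial ts)
contractBranches-trivial []       = ≡.refl
contractBranches-trivial (t ∷ ts) = ≡.cong₂ _∷_ (contract-trivial t) (contractBranches-trivial ts)

keptBranches-trivial : ∀ ts → keptBranches (trivialBranches ts) ≡ []
keptBranches-trivial []       = ≡.refl
keptBranches-trivial (t ∷ ts) = keptBranches-trivial ts

components-trivial : ∀ t → components (trivialSubforest t) ≡ []
branchComponents-trivial : ∀ ts → branchComponents (trivialBranches ts) ≡ []
components-trivial (B₊ ts) =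
  ≡.cong₂ (λ us m → tree→monomial (B₊ us) ++ m) (keptBranches-trivial ts) (branchComponents-trivial ts)
branchComponents-trivial []       = ≡.refl
branchComponents-trivial (t ∷ ts) = ≡.cong₂ _++_ (components-trivial t) (branchComponents-trivial ts)

fullSubforest : ∀ t → Subforest t
fullBranches : ∀ ts → Branches ts
fullSubforest (B₊ ts) = join (fullBranches ts)
fullBranches []       = []
fullBranches (t ∷ ts) = keep (fullSubforest t) (fullBranches ts)

rootComponent-full : ∀ t → rootComponent (fullSubforest t) ≡ t
keptBranches-full : ∀ ts → keptBranches (fullBranches ts) ≡ ts
rootComponent-full (B₊ ts) = ≡.cong B₊ (keptBranches-full ts)
keptBranches-full []       = ≡.refl
keptBranches-full (t ∷ ts) = ≡.cong₂ _∷_ (rootComponent-full t) (keptBranches-full ts)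

otherComponents-full : ∀ t → otherComponents (fullSubforest t) ≡ []
branchComponents-full : ∀ ts → branchComponents (fullBranches ts) ≡ []
otherComponents-full (B₊ ts) = branchComponents-full ts
branchComponents-full []       = ≡.refl
branchComponents-full (t ∷ ts) = ≡.cong₂ _++_ (otherComponents-full t) (branchComponents-full ts)

components-full : ∀ t → components (fullSubforest t) ≡ tree→monomial t
components-full t = ≡.trans
  (≡.cong₂ (λ u m → tree→monomial u ++ m) (rootComponent-full t) (otherComponents-full t))
  (List.++-identityʳ (tree→monomial t))

∣contract∣-≤ : ∀ {t} (s : Subforest t) → ∣ contract s ∣ ℕ.≤ ∣ t ∣
∣contractBranches∣-≤ : ∀ {ts} (bs : Branches ts) → ∣ contractBranches bs ∣ᶠ ℕ.≤ ∣ ts ∣ᶠ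
∣contractBranches-keep∣-< : ∀ {t ts} (s : Subforest t) (bs : Branches ts) →
  ∣ contractBranches (keep s bs) ∣ᶠ ℕ.< ∣ t ∷ ts ∣ᶠ
∣contract∣-≤ (join bs) = s≤s (∣contractBranches∣-≤ bs)
∣contractBranches∣-≤ []          = z≤n
∣contractBranches∣-≤ (keep s bs) = ℕ.<⇒≤ (∣contractBranches-keep∣-< s bs)
∣contractBranches∣-≤ (omit s bs) = ℕ.+-mono-≤ (∣contract∣-≤ s) (∣contractBranches∣-≤ bs)
∣contractBranches-keep∣-< {t} {ts} s bs = ≡.subst (ℕ._< ∣ t ∷ ts ∣ᶠ)
  (≡.sym (∣∣ᶠ-++ (contractedBranches s) (contractBranches bs)))
  -- `contract s` computes to one vertex more than `contractedBranches s`, namely the vertex lost by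
  -- keeping the edge; so this weak inequality is already the strict one.
  (ℕ.+-mono-≤ (∣contract∣-≤ s) (∣contractBranches∣-≤ bs))

-- Inverse factorials, the character `E` and strict order polynomials

module OrderPolynomials {c ℓ₁ ℓ₂} (k : HeytingField c ℓ₁ ℓ₂) (char0 : CharacteristicZero k) where

  open TreeHopfAlgebras k char0
    hiding (Carrier; _≈_; _+_; _*_; -_; _-_; 0#; 1#; heytingCommutativeRing; #⇒invertible)
  open CommutativeRing commutativeRing hiding (zero)
  open RingProperties ring using (-0#≈0#; -‿distribˡ-*; -‿involutive; -1*x≈-x)
  open SemiringMult semiring using (×1-homo-*)
  open SemiringSolver commutativeSemiring using (solve; _:=_; _:+_; _:*_; con)
  open SetoidReasoning setoid
  open RingSums commutativeRing
  open FreeModuleProperties commutativeRing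

  1/-inverse : ∀ n .⦃ _ : NonZero n ⦄ → 1/ n * ι n ≈ 1#
  1/-inverse n = trans (*-congˡ (sym (trans (+-congˡ -0#≈0#) (+-identityʳ (ι n)))))
                       (proj₁ (proj₂ (HeytingField.#⇒invertible k (char0 n))))

  1/-unique : ∀ n .⦃ _ : NonZero n ⦄ a → a * ι n ≈ 1# → a ≈ 1/ n
  1/-unique n a aι≈1 = begin
    a                    ≈⟨ trans (sym (*-identityʳ a)) (*-congˡ (sym (1/-inverse n))) ⟩
    a * (1/ n * ι n)     ≈⟨ solve 3 (λ a b c → a :* (b :* c) := (a :* c) :* b) refl a (1/ n) (ι n) ⟩
    a * ι n * 1/ n       ≈⟨ trans (*-congʳ aι≈1) (*-identityˡ (1/ n)) ⟩
    1/ n                 ∎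

  1/-1 : 1/ 1 ≈ 1#
  1/-1 = sym (1/-unique 1 1# (trans (*-identityˡ _) (+-identityʳ 1#)))

  1/-* : ∀ m n .⦃ _ : NonZero m ⦄ .⦃ _ : NonZero n ⦄ .⦃ _ : NonZero (m ℕ.* n) ⦄ →
         1/ (m ℕ.* n) ≈ 1/ m * 1/ n
  1/-* m n = sym (1/-unique (m ℕ.* n) _ (begin
    1/ m * 1/ n * ι (m ℕ.* n)      ≈⟨ *-congˡ (×1-homo-* m n) ⟩
    1/ m * 1/ n * (ι m * ι n)      ≈⟨ solve 4 (λ a b x y → (a :* b) :* (x :* y) := (a :* x) :* (b :* y))
                                        refl (1/ m) (1/ n) (ι m) (ι n) ⟩
    1/ m * ι m * (1/ n * ι n)      ≈⟨ *-cong (1/-inverse m) (1/-inverse n) ⟩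
    1# * 1#                        ≈⟨ *-identityˡ 1# ⟩
    1#                             ∎))

  1/-cong : ∀ {m n} .{m≢0 : NonZero m} .{n≢0 : NonZero n} → m ≡ n → 1/ m ⦃ m≢0 ⦄ ≈ 1/ n ⦃ n≢0 ⦄
  1/-cong ≡.refl = refl

  1/! : Tree → Carrier
  1/! t = 1/ (t !) ⦃ !-nonZero t ⦄

  1/!ᶠ : Forest → Carrier
  1/!ᶠ ts = 1/ (ts !ᶠ) ⦃ !ᶠ-nonZero ts ⦄

  1/!-B₊ : ∀ ts → 1/! (B₊ ts) ≈ 1/ ∣ B₊ ts ∣ * 1/!ᶠ ts
  1/!-B₊ ts = 1/-* ∣ B₊ ts ∣ (ts !ᶠ) ⦃ _ ⦄ ⦃ !ᶠ-nonZero ts ⦄ ⦃ !-nonZero (B₊ ts) ⦄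

  1/!ᶠ-∷ : ∀ t ts → 1/!ᶠ (t ∷ ts) ≈ 1/! t * 1/!ᶠ ts
  1/!ᶠ-∷ t ts = 1/-* (t !) (ts !ᶠ) ⦃ !-nonZero t ⦄ ⦃ !ᶠ-nonZero ts ⦄ ⦃ !ᶠ-nonZero (t ∷ ts) ⦄

  E-++ : ∀ m m′ → E (η (m ++ m′)) ≈ E (η m) * E (η m′)
  E-++ []      m′ = sym (*-identityˡ _)
  E-++ (t ∷ m) m′ = trans (*-congˡ (E-++ m m′)) (sym (*-assoc _ _ _))

  E-monomial : ∀ t → E (η (tree→monomial t)) ≈ 1/! t
  E-monomial (B₊ [])       = sym 1/-1
  E-monomial (B₊ (t ∷ ts)) = *-identityʳ _

  -- The antipode law is an equality modulo `≋`; this is what allows `E` to be applied to both of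
  -- its sides.
  E-cong : ∀ {x y} → x ≋ y → E x ≈ E y
  E-cong = linearForm-cong go
    where
    open Setoid tree⁺Setoid using () renaming (_≈_ to _≅⁺_)

    1/!-cong : ∀ (t u : Tree⁺) → t ≅⁺ u → 1/! (proj₁ t) ≈ 1/! (proj₁ u)
    1/!-cong (t , _) (u , _) p = 1/-cong {m≢0 = !-nonZero t} {n≢0 = !-nonZero u} (!-cong p)

    go-≋ : ∀ {m m′} → Pointwise _≅⁺_ m m′ → E (η m) ≈ E (η m′)
    go-≋ []       = refl
    go-≋ {t ∷ _} {u ∷ _} (p ∷ ps) = *-cong (1/!-cong t u p) (go-≋ ps)

    go : ∀ {m m′} → Permutation _≅⁺_ m m′ → E (η m) ≈ E (η m′)
    go (Homogeneous.refl ps)    = go-≋ ps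
    go (Homogeneous.prep {x = t} {y = u} p q) = *-cong (1/!-cong t u p) (go q)
    go (Homogeneous.swap {x = t} {y = u} {x′ = t′} {y′ = u′} p q r) = trans
      (*-cong (1/!-cong t t′ p) (*-cong (1/!-cong u u′ q) (go r)))
      (solve 3 (λ a b x → a :* (b :* x) := b :* (a :* x)) (refl) _ _ _)
    go (Homogeneous.trans p q)  = trans (go p) (go q)

  Σ-branches-∷ : ∀ t ts (f : Branches (t ∷ ts) → Carrier) →
    Σˡ (branches (t ∷ ts)) f ≈
    Σˡ (subforests t) (λ s → Σˡ (branches ts) λ bs → f (keep s bs)) +
    Σˡ (subforests t) (λ s → Σˡ (branches ts) λ bs → f (omit s bs))
  Σ-branches-∷ t ts f = trans (Σˡ-++ (cartesianProductWith keep (subforests t) (branches ts)) _ f)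
    (+-cong (Σˡ-cartesianProductWith keep (subforests t) (branches ts) f)
            (Σˡ-cartesianProductWith omit (subforests t) (branches ts) f))

  Σ-decompositions-∷ : ∀ us ts (f : Decomposition (B₊ us ∷ ts) → Carrier) →
    Σˡ (decompositions (B₊ us ∷ ts)) f ≈
    Σˡ (decompositions ts) (f ∘ allInV) +
    Σˡ (decompositions us) (λ d₁ → Σˡ (decompositions ts) λ d₂ → f (rootInW d₁ d₂))
  Σ-decompositions-∷ us ts f = trans (Σˡ-++ (map allInV (decompositions ts)) _ f)
    (+-cong (Σˡ-map allInV (decompositions ts) f)
            (Σˡ-cartesianProductWith rootInW (decompositions us) (decompositions ts) f))

  -- The strict order polynomial: Ω n t is the number of maps from the vertices of t
  -- to an n-element chain that are strictly monotone along the edges.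

  Ω : ℕ → Tree → Carrier
  Ωᶠ : ℕ → Forest → Carrier
  Ω zero    t       = 0#
  Ω (suc n) (B₊ ts) = Ω n (B₊ ts) + Ωᶠ n ts
  Ωᶠ n []       = 1#
  Ωᶠ n (t ∷ ts) = Ω n t * Ωᶠ n ts

  Ωᶠ-++ : ∀ n ts us → Ωᶠ n (ts ++ us) ≈ Ωᶠ n ts * Ωᶠ n us
  Ωᶠ-++ n []       us = sym (*-identityˡ _)
  Ωᶠ-++ n (t ∷ ts) us = trans (*-congˡ (Ωᶠ-++ n ts us)) (sym (*-assoc _ _ _))

  -- Sums over decompositions

  δ-++ : ∀ ts us → δ (η (ts ++ us)) ≈ δ (η ts) * δ (η us)
  δ-++ []       us = sym (*-identityˡ _)
  δ-++ (t ∷ ts) us = trans (*-congˡ (δ-++ ts us)) (sym (*-assoc _ _ _))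

  ε-++ : ∀ ts us → ε (η (ts ++ us)) ≈ ε (η ts) * ε (η us)
  ε-++ []       us = sym (*-identityˡ _)
  ε-++ (t ∷ ts) us = sym (zeroˡ _)

  Ω-0 : ∀ us → Ωᶠ 0 us ≈ ε (η us)
  Ω-0 []       = refl
  Ω-0 (t ∷ us) = zeroˡ _

  δ-• : ∀ us → δ (η (B₊ us ∷ [])) ≈ ε (η us)
  δ-• []       = *-identityʳ 1#
  δ-• (t ∷ us) = zeroˡ 1#

  δ-∷ : ∀ t ts → δ (η (t ∷ ts)) ≈ δ (η (t ∷ [])) * δ (η ts)
  δ-∷ t ts = δ-++ (t ∷ []) ts

  -- `F` is arbitrary so that the induction can run inside a tree, with `F` precomposed with w ↦
  -- `B₊ w ∷ ts`.
  ε∗ : ∀ (F : Forest → Carrier) u → Σˡ (decompositions u) (λ d → ε (η (V-part d)) * F (W-part d)) ≈ F u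
  ε∗ F []          = trans (+-identityʳ _) (*-identityˡ _)
  ε∗ F (B₊ us ∷ ts) = begin
    Σˡ (decompositions (B₊ us ∷ ts)) (λ d → ε (η (V-part d)) * F (W-part d))
      ≈⟨ Σ-decompositions-∷ us ts _ ⟩
    Σˡ (decompositions ts) (λ d → 0# * F (W-part d)) +
    Σˡ (decompositions us) (λ d₁ → Σˡ (decompositions ts) λ d₂ →
      ε (η (V-part d₁ ++ V-part d₂)) * F (B₊ (W-part d₁) ∷ W-part d₂))
      ≈⟨ +-cong (Σˡ-zero (decompositions ts) λ d → zeroˡ _)
                (Σˡ-cong (decompositions us) λ d₁ → inner d₁) ⟩
    0# + Σˡ (decompositions us) (λ d₁ → ε (η (V-part d₁)) * F (B₊ (W-part d₁) ∷ ts))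
      ≈⟨ trans (+-identityˡ _) (ε∗ (λ w → F (B₊ w ∷ ts)) us) ⟩
    F (B₊ us ∷ ts) ∎
    where
    inner : ∀ d₁ → Σˡ (decompositions ts) (λ d₂ →
      ε (η (V-part d₁ ++ V-part d₂)) * F (B₊ (W-part d₁) ∷ W-part d₂))
      ≈ ε (η (V-part d₁)) * F (B₊ (W-part d₁) ∷ ts)
    inner d₁ = begin
      _ ≈⟨ Σˡ-cong (decompositions ts) (λ d₂ → trans (*-congʳ (ε-++ (V-part d₁) (V-part d₂))) (*-assoc _ _ _)) ⟩
      _ ≈⟨ Σˡ-*ˡ (decompositions ts) (ε (η (V-part d₁))) (λ d₂ → ε (η (V-part d₂)) * F (B₊ (W-part d₁) ∷ W-part d₂)) ⟩
      _ ≈⟨ *-congˡ (ε∗ (λ w → F (B₊ (W-part d₁) ∷ w)) ts) ⟩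
      _ ∎

  -- Convolution on the left by δ peels off the top level of a strictly monotone
  -- map, while the recursion for Ω peels off the bottom one.

  δ∗Ωᶠ : ∀ n u → Σˡ (decompositions u) (λ d → δ (η (V-part d)) * Ωᶠ n (W-part d)) ≈ Ωᶠ (suc n) u
  -- The separate summand is the decomposition with the root in V, which leaves nothing for W; the
  -- sum has the root in W. For n = 0 both sides test whether the tree is a single vertex.
  δ∗Ω : ∀ n us → δ (η (B₊ us ∷ [])) + Σˡ (decompositions us) (λ d → δ (η (V-part d)) * Ω n (B₊ (W-part d)))
                 ≈ Ω (suc n) (B₊ us)
  δ∗Ωᶠ n []           = trans (+-identityʳ _) (*-identityˡ _)
  δ∗Ωᶠ n (B₊ us ∷ ts) = begin
    Σˡ (decompositions (B₊ us ∷ ts)) (λ d → δ (η (V-part d)) * Ωᶠ n (W-part d))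
      ≈⟨ Σ-decompositions-∷ us ts _ ⟩
    Σˡ (decompositions ts) (λ d → δ (η (B₊ us ∷ V-part d)) * Ωᶠ n (W-part d)) +
    Σˡ (decompositions us) (λ d₁ → Σˡ (decompositions ts) λ d₂ →
      δ (η (V-part d₁ ++ V-part d₂)) * (Ω n (B₊ (W-part d₁)) * Ωᶠ n (W-part d₂)))
      ≈⟨ +-cong
           (trans (Σˡ-cong (decompositions ts) λ d → trans (*-congʳ (δ-∷ (B₊ us) (V-part d))) (*-assoc _ _ _))
                  (Σˡ-*ˡ (decompositions ts) _ _))
           (trans (Σˡ-cong (decompositions us) λ d₁ → Σˡ-cong (decompositions ts) λ d₂ →
                    trans (*-congʳ (δ-++ (V-part d₁) (V-part d₂)))
                          (solve 4 (λ a b x y → (a :* b) :* (x :* y) := (a :* x) :* (b :* y)) refl _ _ _ _))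
                  (Σˡ-* (decompositions us) (decompositions ts) _ _)) ⟩
    δ (η (B₊ us ∷ [])) * top + Σˡ (decompositions us) (λ d → δ (η (V-part d)) * Ω n (B₊ (W-part d))) * top
      ≈⟨ sym (distribʳ top _ _) ⟩
    (δ (η (B₊ us ∷ [])) + Σˡ (decompositions us) (λ d → δ (η (V-part d)) * Ω n (B₊ (W-part d)))) * top
      ≈⟨ *-cong (δ∗Ω n us) (δ∗Ωᶠ n ts) ⟩
    Ω (suc n) (B₊ us) * Ωᶠ (suc n) ts ∎
    where
    top : Carrier
    top = Σˡ (decompositions ts) λ d → δ (η (V-part d)) * Ωᶠ n (W-part d)
  δ∗Ω zero us = begin
    δ (η (B₊ us ∷ [])) + Σˡ (decompositions us) (λ d → δ (η (V-part d)) * 0#)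
      ≈⟨ +-cong (δ-• us) (Σˡ-zero (decompositions us) λ d → zeroʳ _) ⟩
    ε (η us) + 0#
      ≈⟨ trans (+-comm _ _) (+-congˡ (sym (Ω-0 us))) ⟩
    0# + Ωᶠ 0 us ∎
  δ∗Ω (suc n) us = begin
    δ (η (B₊ us ∷ [])) + Σˡ (decompositions us) (λ d → δ (η (V-part d)) * (Ω n (B₊ (W-part d)) + Ωᶠ n (W-part d)))
      ≈⟨ +-congˡ (trans (Σˡ-cong (decompositions us) λ d → distribˡ _ _ _) (Σˡ-+ (decompositions us) _ _)) ⟩
    δ (η (B₊ us ∷ [])) + (Σˡ (decompositions us) (λ d → δ (η (V-part d)) * Ω n (B₊ (W-part d)))
                          + Σˡ (decompositions us) (λ d → δ (η (V-part d)) * Ωᶠ n (W-part d)))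
      ≈⟨ sym (+-assoc _ _ _) ⟩
    (δ (η (B₊ us ∷ [])) + Σˡ (decompositions us) (λ d → δ (η (V-part d)) * Ω n (B₊ (W-part d))))
      + Σˡ (decompositions us) (λ d → δ (η (V-part d)) * Ωᶠ n (W-part d))
      ≈⟨ +-cong (δ∗Ω n us) (δ∗Ωᶠ n us) ⟩
    Ω (suc n) (B₊ us) + Ωᶠ (suc n) us ∎

  [δ-ε]∗Ωᶠ : ∀ n u → Σˡ (decompositions u) (λ d → (δ (η (V-part d)) - ε (η (V-part d))) * Ωᶠ n (W-part d))
                     ≈ Ωᶠ (suc n) u - Ωᶠ n u
  [δ-ε]∗Ωᶠ n u = begin
    Σˡ (decompositions u) (λ d → (δ (η (V-part d)) - ε (η (V-part d))) * Ωᶠ n (W-part d))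
      ≈⟨ Σˡ-cong (decompositions u) (λ d → trans (distribʳ _ _ _) (+-congˡ (trans (sym (-‿distribˡ-* _ _)) (sym (-1*x≈-x _))))) ⟩
    Σˡ (decompositions u) (λ d → δ (η (V-part d)) * Ωᶠ n (W-part d) + (- 1#) * (ε (η (V-part d)) * Ωᶠ n (W-part d)))
      ≈⟨ trans (Σˡ-+ (decompositions u) _ _) (+-congˡ (Σˡ-*ˡ (decompositions u) (- 1#) _)) ⟩
    Σˡ (decompositions u) (λ d → δ (η (V-part d)) * Ωᶠ n (W-part d))
      + (- 1#) * Σˡ (decompositions u) (λ d → ε (η (V-part d)) * Ωᶠ n (W-part d))
      ≈⟨ +-cong (δ∗Ωᶠ n u) (trans (*-congˡ (ε∗ (Ωᶠ n) u)) (-1*x≈-x _)) ⟩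
    Ωᶠ (suc n) u - Ωᶠ n u ∎

  -- The coefficients δ - ε of the decompositions do not depend on m, so the n differences move
  -- outside the sum, where `[δ-ε]∗Ωᶠ` supplies one more.
  [δ-ε]^∗ : ∀ n u → ((λ y → δ y - ε y) ^∗ n) (η u) ≈ diff n (λ m → Ωᶠ m u) 0
  [δ-ε]^∗ zero    u = sym (Ω-0 u)
  [δ-ε]^∗ (suc n) u = begin
    ((λ y → δ y - ε y) ^∗ suc n) (η u)
      ≡⟨ linearForm-∑ _ (decompositions u) _ ⟩
    Σˡ (decompositions u) (λ d → (δ (η (V-part d)) - ε (η (V-part d))) * ((λ y → δ y - ε y) ^∗ n) (η (W-part d)))
      ≈⟨ Σˡ-cong (decompositions u) (λ d → *-congˡ ([δ-ε]^∗ n (W-part d))) ⟩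
    Σˡ (decompositions u) (λ d → (δ (η (V-part d)) - ε (η (V-part d))) * diff n (λ m → Ωᶠ m (W-part d)) 0)
      ≈⟨ sym (diff-Σˡ n (decompositions u) _ (λ d m → Ωᶠ m (W-part d)) 0) ⟩
    diff n (λ m → Σˡ (decompositions u) λ d → (δ (η (V-part d)) - ε (η (V-part d))) * Ωᶠ m (W-part d)) 0
      ≈⟨ diff-cong n (λ m → [δ-ε]∗Ωᶠ m u) 0 ⟩
    diff n (λ m → Ωᶠ (suc m) u - Ωᶠ m u) 0 ∎

  -- Sums over subforests

  weight : ∀ {t} → Subforest t → Carrier
  weight s = E (η (components s))

  -- Omits the factor 1 / size of the root component, which depends on all branches jointly; what
  -- remains is multiplicative over the branches, for kept and omitted edges alike.
  branchWeight : ∀ {ts} → Branches ts → Carrier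
  branchWeight bs = 1/!ᶠ (keptBranches bs) * E (η (branchComponents bs))

  weight-join : ∀ {ts} (bs : Branches ts) →
    weight (join bs) ≈ 1/ ∣ B₊ (keptBranches bs) ∣ * branchWeight bs
  weight-join bs = begin
    E (η (tree→monomial (B₊ (keptBranches bs)) ++ branchComponents bs))
      ≈⟨ E-++ (tree→monomial (B₊ (keptBranches bs))) (branchComponents bs) ⟩
    E (η (tree→monomial (B₊ (keptBranches bs)))) * E (η (branchComponents bs))
      ≈⟨ *-congʳ (trans (E-monomial (B₊ (keptBranches bs))) (1/!-B₊ (keptBranches bs))) ⟩
    1/ ∣ B₊ (keptBranches bs) ∣ * 1/!ᶠ (keptBranches bs) * E (η (branchComponents bs))
      ≈⟨ *-assoc _ _ _ ⟩
    1/ ∣ B₊ (keptBranches bs) ∣ * branchWeight bs ∎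

  weight-keep : ∀ {t ts} (s : Subforest t) (bs : Branches ts) →
    branchWeight (keep s bs) ≈ weight s * branchWeight bs
  weight-keep s bs = begin
    1/!ᶠ (rootComponent s ∷ keptBranches bs) * E (η (otherComponents s ++ branchComponents bs))
      ≈⟨ *-cong (1/!ᶠ-∷ (rootComponent s) (keptBranches bs)) (E-++ (otherComponents s) (branchComponents bs)) ⟩
    1/! (rootComponent s) * 1/!ᶠ (keptBranches bs) * (E (η (otherComponents s)) * E (η (branchComponents bs)))
      ≈⟨ solve 4 (λ a b x y → (a :* b) :* (x :* y) := (a :* x) :* (b :* y)) refl _ _ _ _ ⟩
    1/! (rootComponent s) * E (η (otherComponents s)) * branchWeight bs
      ≈⟨ *-congʳ (sym (trans (E-++ (tree→monomial (rootComponent s)) (otherComponents s))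
                             (*-congʳ (E-monomial (rootComponent s))))) ⟩
    weight s * branchWeight bs ∎

  weight-omit : ∀ {t ts} (s : Subforest t) (bs : Branches ts) →
    branchWeight (omit s bs) ≈ weight s * branchWeight bs
  weight-omit s bs = trans (*-congˡ (E-++ (components s) (branchComponents bs)))
    (solve 3 (λ a x y → a :* (x :* y) := x :* (a :* y)) refl _ _ _)

  -- E ⋆ Ω n = n^∣t∣ / t!, refined so as to record the size of the component
  -- through the root: the factor 1 / ∣ root component ∣ in the weight of
  -- a subforest is an integration, which inverts the one defining the tree factorial.

  Σ-branches : ∀ n ts (h : ℕ → Carrier) →
    Σˡ (branches ts) (λ bs → h ∣ keptBranches bs ∣ᶠ * (branchWeight bs * Ωᶠ n (contractBranches bs)))
    ≈ umbral (ι n) (∣ ts ∣ᶠ) h * 1/!ᶠ ts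
  -- With u^j for `g j`, the right-hand side is (n + u)^∣t∣ / t!, the volume for [0, n] extended by
  -- an interval of length u. The sum has the root in the extension; the term with `g 0` has it in
  -- [0, n].
  Σ-rooted : ∀ n t (g : ℕ → Carrier) →
    Σˡ (subforests t) (λ s → g ∣ rootComponent s ∣ * (weight s * Ωᶠ n (contractedBranches s)))
    + g 0 * (ι n ^ ∣ t ∣ * 1/! t) ≈ umbral (ι n) (∣ t ∣) g * 1/! t
  Σ-contract : ∀ n t →
    Σˡ (subforests t) (λ s → weight s * Ω n (contract s)) ≈ ι n ^ ∣ t ∣ * 1/! t

  Σ-branches n []       h = trans (+-identityʳ _) (*-congˡ (begin
    1/!ᶠ [] * 1# * 1#   ≈⟨ trans (*-identityʳ _) (*-identityʳ _) ⟩
    1/!ᶠ []             ∎))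
  Σ-branches n (t ∷ ts) h = begin
    Σˡ (branches (t ∷ ts)) (λ bs → h ∣ keptBranches bs ∣ᶠ * (branchWeight bs * Ωᶠ n (contractBranches bs)))
      ≈⟨ Σ-branches-∷ t ts _ ⟩
    Σˡ (subforests t) (λ s → Σˡ (branches ts) λ bs →
      h (∣ rootComponent s ∣ ℕ.+ ∣ keptBranches bs ∣ᶠ)
      * (branchWeight (keep s bs) * Ωᶠ n (contractedBranches s ++ contractBranches bs))) +
    Σˡ (subforests t) (λ s → Σˡ (branches ts) λ bs →
      h ∣ keptBranches bs ∣ᶠ * (branchWeight (omit s bs) * (Ω n (contract s) * Ωᶠ n (contractBranches bs))))
      ≈⟨ +-cong
           (Σˡ-cong (subforests t) λ s → trans
             (Σˡ-cong (branches ts) λ bs → trans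
               (*-congˡ (*-cong (weight-keep s bs) (Ωᶠ-++ n (contractedBranches s) (contractBranches bs))))
               (exchange _ _ _ _ _))
             (trans (Σˡ-*ˡ (branches ts) _ _)
             (trans (*-congˡ (Σ-branches n ts (λ i → h (∣ rootComponent s ∣ ℕ.+ i)))) (*-comm _ _))))
           (Σˡ-cong (subforests t) λ s → trans
             (Σˡ-cong (branches ts) λ bs → trans
               (*-congˡ (*-congʳ (weight-omit s bs)))
               (exchange _ _ _ _ _))
             (trans (Σˡ-*ˡ (branches ts) _ _)
             (trans (*-congˡ (Σ-branches n ts h)) (*-comm _ _)))) ⟩
    Σˡ (subforests t) (λ s → g ∣ rootComponent s ∣ * (weight s * Ωᶠ n (contractedBranches s))) +
    Σˡ (subforests t) (λ s → g 0 * (weight s * Ω n (contract s)))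
      -- An omitted edge leaves the root of `t` outside the component, so nothing is recorded; this
      -- gives the `g 0` term that `Σ-rooted` asks for.
      ≈⟨ +-congˡ (trans (Σˡ-*ˡ (subforests t) _ _) (*-congˡ (Σ-contract n t))) ⟩
    Σˡ (subforests t) (λ s → g ∣ rootComponent s ∣ * (weight s * Ωᶠ n (contractedBranches s))) +
    g 0 * (ι n ^ ∣ t ∣ * 1/! t)
      ≈⟨ Σ-rooted n t g ⟩
    umbral (ι n) (∣ t ∣) g * 1/! t
      ≈⟨ *-congʳ (trans (umbral-*ʳ (ι n) (∣ t ∣) _ (1/!ᶠ ts)) (*-congʳ (sym (umbral-add (ι n) (∣ t ∣) (∣ ts ∣ᶠ) h)))) ⟩
    umbral (ι n) (∣ t ∷ ts ∣ᶠ) h * 1/!ᶠ ts * 1/! t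
      ≈⟨ trans (*-assoc _ _ _) (*-congˡ (trans (*-comm _ _) (sym (1/!ᶠ-∷ t ts)))) ⟩
    umbral (ι n) (∣ t ∷ ts ∣ᶠ) h * 1/!ᶠ (t ∷ ts) ∎
    where
    -- The linear form that first multiplies by (n + u)^∣ts∣ / ts!, the contribution of the
    -- remaining branches.
    g : ℕ → Carrier
    g j = umbral (ι n) (∣ ts ∣ᶠ) (λ i → h (j ℕ.+ i)) * 1/!ᶠ ts

    exchange : ∀ a x y p q → a * ((x * y) * (p * q)) ≈ (x * p) * (a * (y * q))
    exchange = solve 5 (λ a x y p q → a :* ((x :* y) :* (p :* q)) := (x :* p) :* (a :* (y :* q))) refl

  Σ-rooted n (B₊ ts) g = begin
    Σˡ (map join (branches ts)) (λ s → g ∣ rootComponent s ∣ * (weight s * Ωᶠ n (contractedBranches s)))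
      + g 0 * (ι n ^ suc M * 1/! (B₊ ts))
      ≈⟨ +-cong
           (trans (Σˡ-map join (branches ts) _)
           (trans (Σˡ-cong (branches ts) λ bs → trans
                    (*-congˡ (*-congʳ (weight-join bs)))
                    (solve 4 (λ a x y p → a :* ((x :* y) :* p) := (a :* x) :* (y :* p)) refl _ _ _ _))
                  (Σ-branches n ts h)))
           (*-congˡ (*-congˡ (1/!-B₊ ts))) ⟩
    umbral (ι n) M h * 1/!ᶠ ts + g 0 * (ι n ^ suc M * (1/ (suc M) * 1/!ᶠ ts))
      -- Creates the factor `ι (suc M)` of `umbral-integral`; its inverse is the root's factor in 1
      -- / t!.
      ≈⟨ +-congʳ (trans (sym (*-identityˡ _)) (*-congʳ (sym (1/-inverse (suc M))))) ⟩
    1/ (suc M) * ι (suc M) * (umbral (ι n) M h * 1/!ᶠ ts) + g 0 * (ι n ^ suc M * (1/ (suc M) * 1/!ᶠ ts))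
      ≈⟨ solve 6 (λ r i u f a p → (r :* i) :* (u :* f) :+ a :* (p :* (r :* f)) := (p :* a :+ i :* u) :* (r :* f))
           refl (1/ (suc M)) (ι (suc M)) (umbral (ι n) M h) (1/!ᶠ ts) (g 0) (ι n ^ suc M) ⟩
    (ι n ^ suc M * g 0 + ι (suc M) * umbral (ι n) M h) * (1/ (suc M) * 1/!ᶠ ts)
      ≈⟨ *-cong (sym (umbral-integral (ι n) M g h h-integral)) (sym (1/!-B₊ ts)) ⟩
    umbral (ι n) (suc M) g * 1/! (B₊ ts) ∎
    where
    M : ℕ
    M = ∣ ts ∣ᶠ

    -- Integration u^m ↦ u^(m+1) / (m+1): the root adds one vertex to the m kept ones, and the tree
    -- factorial divides by the resulting size.
    h : ℕ → Carrier
    h m = g (suc m) * 1/ (suc m)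

    h-integral : ∀ m → g (suc m) ≈ ι (suc m) * h m
    h-integral m = sym (begin
      ι (suc m) * (g (suc m) * 1/ (suc m))  ≈⟨ solve 3 (λ i a r → i :* (a :* r) := (r :* i) :* a) refl _ _ _ ⟩
      1/ (suc m) * ι (suc m) * g (suc m)    ≈⟨ trans (*-congʳ (1/-inverse (suc m))) (*-identityˡ _) ⟩
      g (suc m)                           ∎)

  Σ-contract zero    t@(B₊ ts) =
    trans (Σˡ-zero (subforests t) λ s → zeroʳ _)
    (sym (trans (*-congʳ (zeroˡ _)) (zeroˡ _)))
  Σ-contract (suc n) t@(B₊ _) = begin
    Σˡ (subforests t) (λ s → weight s * (Ω n (contract s) + Ωᶠ n (contractedBranches s)))
      ≈⟨ trans (Σˡ-cong (subforests t) λ s → distribˡ _ _ _) (Σˡ-+ (subforests t) _ _) ⟩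
    Σˡ (subforests t) (λ s → weight s * Ω n (contract s))
      + Σˡ (subforests t) (λ s → weight s * Ωᶠ n (contractedBranches s))
      ≈⟨ +-cong (trans (Σ-contract n t) (sym (*-identityˡ _)))
                (Σˡ-cong (subforests t) λ s → sym (*-identityˡ _)) ⟩
    1# * (ι n ^ ∣ t ∣ * 1/! t) + Σˡ (subforests t) (λ s → 1# * (weight s * Ωᶠ n (contractedBranches s)))
      -- The constant form is u = 1: the extension is a full unit interval, so n becomes n + 1.
      ≈⟨ trans (+-comm _ _) (Σ-rooted n t (λ _ → 1#)) ⟩
    umbral (ι n) (∣ t ∣) (λ _ → 1#) * 1/! t
      ≈⟨ *-congʳ (umbral-1 (ι n) (∣ t ∣)) ⟩
    ι (suc n) ^ ∣ t ∣ * 1/! t ∎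

  -- Unitriangularity of `E ⋆ _`

  -- The indicator of the trivial subforest, with values in k so that multiplying by it extracts a
  -- single term of a sum.
  nothingKept : ∀ {t} → Subforest t → Carrier
  nothingKeptᶠ : ∀ {ts} → Branches ts → Carrier
  nothingKept (join bs) = nothingKeptᶠ bs
  nothingKeptᶠ []          = 1#
  nothingKeptᶠ (keep s bs) = 0#
  nothingKeptᶠ (omit s bs) = nothingKept s * nothingKeptᶠ bs

  Σ-nothingKept : ∀ t (f : Subforest t → Carrier) →
    Σˡ (subforests t) (λ s → nothingKept s * f s) ≈ f (trivialSubforest t)
  Σ-nothingKeptᶠ : ∀ ts (f : Branches ts → Carrier) →
    Σˡ (branches ts) (λ bs → nothingKeptᶠ bs * f bs) ≈ f (trivialBranches ts)
  Σ-nothingKept (B₊ ts) f = trans (Σˡ-map join (branches ts) _) (Σ-nothingKeptᶠ ts (f ∘ join))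
  Σ-nothingKeptᶠ []       f = trans (+-identityʳ _) (*-identityˡ _)
  Σ-nothingKeptᶠ (t ∷ ts) f = begin
    Σˡ (branches (t ∷ ts)) (λ bs → nothingKeptᶠ bs * f bs)
      ≈⟨ Σ-branches-∷ t ts _ ⟩
    Σˡ (subforests t) (λ s → Σˡ (branches ts) λ bs → 0# * f (keep s bs)) +
    Σˡ (subforests t) (λ s → Σˡ (branches ts) λ bs → nothingKept s * nothingKeptᶠ bs * f (omit s bs))
      ≈⟨ +-cong (Σˡ-zero (subforests t) λ s → Σˡ-zero (branches ts) λ bs → zeroˡ _)
                (Σˡ-cong (subforests t) λ s → trans
                  (Σˡ-cong (branches ts) λ bs → *-assoc _ _ _)
                  (trans (Σˡ-*ˡ (branches ts) _ _) (*-congˡ (Σ-nothingKeptᶠ ts (f ∘ omit s))))) ⟩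
    0# + Σˡ (subforests t) (λ s → nothingKept s * f (omit s (trivialBranches ts)))
      ≈⟨ trans (+-identityˡ _) (Σ-nothingKept t _) ⟩
    f (trivialBranches (t ∷ ts)) ∎

  nothingKept-or-smaller : ∀ {t} (s : Subforest t) → nothingKept s ≈ 1# ⊎ ∣ contract s ∣ ℕ.< ∣ t ∣
  nothingKept-or-smallerᶠ : ∀ {ts} (bs : Branches ts) →
    nothingKeptᶠ bs ≈ 1# ⊎ ∣ contractBranches bs ∣ᶠ ℕ.< ∣ ts ∣ᶠ
  nothingKept-or-smaller (join bs) with nothingKept-or-smallerᶠ bs
  ... | inj₁ ≈1 = inj₁ ≈1
  ... | inj₂ lt = inj₂ (s≤s lt)
  nothingKept-or-smallerᶠ []          = inj₁ refl
  nothingKept-or-smallerᶠ (keep s bs) = inj₂ (∣contractBranches-keep∣-< s bs)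
  nothingKept-or-smallerᶠ (omit s bs) with nothingKept-or-smaller s | nothingKept-or-smallerᶠ bs
  ... | inj₂ lt | _       = inj₂ (ℕ.+-mono-<-≤ lt (∣contractBranches∣-≤ bs))
  ... | inj₁ _  | inj₂ lt = inj₂ (ℕ.+-mono-≤-< (∣contract∣-≤ s) lt)
  ... | inj₁ p  | inj₁ q  = inj₁ (trans (*-cong p q) (*-identityˡ 1#))

  properWeight : ∀ {t} → Subforest t → Carrier
  properWeight s = (1# - nothingKept s) * weight s

  -- The trivial subforest has weight 1 and contracts nothing, so `X t` is E ⋆ X minus the terms
  -- with smaller contractions. Used for `Ω n` and for `Lᵗ`, which thus obey the same recursion.
  Σ-isolate : ∀ (X : Tree → Carrier) t →
    X t ≈ Σˡ (subforests t) (λ s → weight s * X (contract s))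
          + (- 1#) * Σˡ (subforests t) (λ s → properWeight s * X (contract s))
  Σ-isolate X t = sym (begin
    Σˡ (subforests t) (λ s → weight s * X (contract s))
      + (- 1#) * Σˡ (subforests t) (λ s → properWeight s * X (contract s))
      ≈⟨ +-congˡ (sym (Σˡ-*ˡ (subforests t) (- 1#) _)) ⟩
    Σˡ (subforests t) (λ s → weight s * X (contract s))
      + Σˡ (subforests t) (λ s → (- 1#) * (properWeight s * X (contract s)))
      ≈⟨ sym (Σˡ-+ (subforests t) _ _) ⟩
    Σˡ (subforests t) (λ s → weight s * X (contract s) + (- 1#) * (properWeight s * X (contract s)))
      ≈⟨ Σˡ-cong (subforests t) (λ s → cancel (nothingKept s) (weight s) (X (contract s))) ⟩
    Σˡ (subforests t) (λ s → nothingKept s * (weight s * X (contract s)))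
      ≈⟨ Σ-nothingKept t _ ⟩
    weight (trivialSubforest t) * X (contract (trivialSubforest t))
      ≈⟨ reflexive (≡.cong₂ (λ m u → E (η m) * X u) (components-trivial t) (contract-trivial t)) ⟩
    1# * X t
      ≈⟨ *-identityˡ _ ⟩
    X t ∎)
    where
    cancel : ∀ z w x → w * x + (- 1#) * ((1# - z) * w * x) ≈ z * (w * x)
    cancel z w x = begin
      w * x + (- 1#) * ((1# - z) * w * x)
        ≈⟨ solve 4 (λ m y w x → w :* x :+ m :* ((con 1 :+ y) :* w :* x)
                           := (w :* x) :* (con 1 :+ m) :+ (m :* y) :* (w :* x))
             refl (- 1#) (- z) w x ⟩
      w * x * (1# - 1#) + (- 1#) * (- z) * (w * x)
        ≈⟨ +-cong (trans (*-congˡ (-‿inverseʳ 1#)) (zeroʳ _))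
                  (*-congʳ (trans (-1*x≈-x (- z)) (-‿involutive z))) ⟩
      0# + z * (w * x)
        ≈⟨ +-identityˡ _ ⟩
      z * (w * x) ∎

  -- The factor `ε` tests whether t / s is a single vertex, which happens only when every edge is
  -- kept.
  Σ-fullyKept : ∀ t (f : Subforest t → Carrier) →
    Σˡ (subforests t) (λ s → f s * ε (η (contractedBranches s))) ≈ f (fullSubforest t)
  Σ-fullyKeptᶠ : ∀ ts (f : Branches ts → Carrier) →
    Σˡ (branches ts) (λ bs → f bs * ε (η (contractBranches bs))) ≈ f (fullBranches ts)
  Σ-fullyKept (B₊ ts) f = trans (Σˡ-map join (branches ts) _) (Σ-fullyKeptᶠ ts (f ∘ join))
  Σ-fullyKeptᶠ []       f = trans (+-identityʳ _) (*-identityʳ _)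
  Σ-fullyKeptᶠ (t ∷ ts) f = begin
    Σˡ (branches (t ∷ ts)) (λ bs → f bs * ε (η (contractBranches bs)))
      ≈⟨ Σ-branches-∷ t ts _ ⟩
    Σˡ (subforests t) (λ s → Σˡ (branches ts) λ bs →
      f (keep s bs) * ε (η (contractedBranches s ++ contractBranches bs))) +
    Σˡ (subforests t) (λ s → Σˡ (branches ts) λ bs → f (omit s bs) * 0#)
      ≈⟨ +-cong (Σˡ-cong (subforests t) λ s → trans
                  (Σˡ-cong (branches ts) λ bs → trans (*-congˡ (ε-++ (contractedBranches s) (contractBranches bs)))
                    (solve 3 (λ a x y → a :* (x :* y) := (a :* y) :* x) refl
                      (f (keep s bs)) (ε (η (contractedBranches s))) (ε (η (contractBranches bs)))))
                  (trans (Σˡ-*ʳ (branches ts) (λ bs → f (keep s bs) * ε (η (contractBranches bs)))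
                                              (ε (η (contractedBranches s))))
                         (*-congʳ (Σ-fullyKeptᶠ ts (f ∘ keep s)))))
                (Σˡ-zero (subforests t) λ s → Σˡ-zero (branches ts) λ bs → zeroʳ _) ⟩
    Σˡ (subforests t) (λ s → f (keep s (fullBranches ts)) * ε (η (contractedBranches s))) + 0#
      ≈⟨ trans (+-identityʳ _) (Σ-fullyKept t (λ s → f (keep s (fullBranches ts)))) ⟩
    f (fullBranches (t ∷ ts)) ∎

  -- From the antipode to the derivative of the order polynomial

  module _ (S : ℋ → ℋ) (isAntipode : IsAntipode S) where

    open IsAntipode isAntipode using (inverseʳ)

    Lᵗ : Tree → Carrier
    Lᵗ t = L S (η (tree→monomial t))

    private
      h : List Tree⁺ × List Tree⁺ → Carrier
      h (i , j) = E (η i) * L S (η j)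

    -- Apply `E` to `inverseʳ`: since `E` is multiplicative, E (a S(b)) = E (a) L (b).
    E⋆L : ∀ x → linearForm h (Δ x) ≈ counit tree⁺Setoid x
    E⋆L x = begin
      linearForm h (Δ x)                          ≈⟨ linearForm-ext (λ (i , j) → sym (E-μ i j)) (Δ x) ⟩
      linearForm (λ (i , j) → E (μ (η i ⊠ S (η j)))) (Δ x)
        ≈⟨ linearForm-ext (λ (i , j) → reflexive (linearForm-linearMap _ _ (η i ⊠ S (η j)))) (Δ x) ⟩
      _                                           ≡⟨ linearForm-linearMap _ _ (Δ x) ⟨
      _                                           ≡⟨ linearForm-linearMap _ _ ((id ⊗ S) (Δ x)) ⟨
      E (μ ((id ⊗ S) (Δ x)))                      ≈⟨ E-cong (inverseʳ x) ⟩
      counit tree⁺Setoid x * 1#                   ≈⟨ *-identityʳ _ ⟩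
      counit tree⁺Setoid x                        ∎
      where
      open MonoidAlgebra ℋ-monomials using (μ)

      E-μ : ∀ i j → E (μ (η i ⊠ S (η j))) ≈ E (η i) * L S (η j)
      E-μ i j = linearForm-multiplicative ℋ-monomials E-++ (η i) (S (η j))

    Σ-antipode : ∀ t →
      Σˡ (subforests t) (λ s → weight s * Lᵗ (contract s)) ≈ counit tree⁺Setoid (η (tree→monomial t))
    -- The monomial of • is empty, so this case is the antipode law at the unit of ℋ.
    Σ-antipode (B₊ [])        = trans (+-identityʳ _) (E⋆L (η []))
    Σ-antipode t@(B₊ (_ ∷ _)) = begin
      Σˡ (subforests t) (λ s → weight s * Lᵗ (contract s))
        ≡⟨ linearForm-∑ h (subforests t) _ ⟨
      linearForm h (∑ (subforests t) λ s → η (components s , tree→monomial (contract s)))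
        -- On a one-tree monomial `Δ` still multiplies by the unit at the end of the list, whence
        -- the trailing `++ []`.
        ≈⟨ linearForm-ext (λ (i , j) → reflexive (≡.cong₂ (λ i j → h (i , j))
             (≡.sym (List.++-identityʳ i)) (≡.sym (List.++-identityʳ j))))
             (∑ (subforests t) λ s → η (components s , tree→monomial (contract s))) ⟩
      _
        ≈⟨ linearForm-μ (DirectProduct.commutativeMonoid ℋ-monomials ℋ-monomials) h
             (∑ (subforests t) λ s → η (components s , tree→monomial (contract s))) (η ([] , [])) ⟨
      linearForm h (Δ (η [ t , tt ]))
        ≈⟨ E⋆L (η [ t , tt ]) ⟩
      0# ∎

    hasDerivative-base : ∀ t →
      HasDerivative (λ n → ι n ^ ∣ t ∣ * 1/! t) (counit tree⁺Setoid (η (tree→monomial t)))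
    hasDerivative-base (B₊ []) =
      (λ _ → 1#) , polynomial-const 1# , refl ,
      λ n → *-cong (*-identityʳ (ι n)) 1/-1
    -- The nonempty list of branches exposes the exponent `∣ ts ∣ᶠ` as a successor, so the cofactor
    -- vanishes at 0.
    hasDerivative-base t@(B₊ ts@(B₊ _ ∷ _)) =
      (λ n → ι n ^ ∣ ts ∣ᶠ * 1/! t) ,
      polynomial-* (polynomial-ι^ ∣ ts ∣ᶠ) (polynomial-const (1/! t)) ,
      trans (*-congʳ (zeroˡ _)) (zeroˡ (1/! t)) , λ n → *-assoc (ι n) (ι n ^ ∣ ts ∣ᶠ) (1/! t)

    -- `Ω n` and `Lᵗ` obey one triangular recursion with different inhomogeneous terms, which
    -- `hasDerivative-base` relates. The bound `N` makes the induction on size structural.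
    Ω-hasDerivative-L : ∀ N t → ∣ t ∣ ℕ.< N → HasDerivative (λ n → Ω n t) (Lᵗ t)
    Ω-hasDerivative-L (suc N) t (s≤s ∣t∣≤N) = hasDerivative-cong
      (λ n → sym (trans (Σ-isolate (Ω n) t) (+-congʳ (Σ-contract n t))))
      (sym (trans (Σ-isolate Lᵗ t) (+-congʳ (Σ-antipode t))))
      (hasDerivative-+ (hasDerivative-base t)
        (hasDerivative-*ˡ (- 1#) (hasDerivative-Σˡ (subforests t) term)))
      where
      term : ∀ s → HasDerivative (λ n → properWeight s * Ω n (contract s)) (properWeight s * Lᵗ (contract s))
      term s with nothingKept-or-smaller s
      ... | inj₂ lt = hasDerivative-*ˡ (properWeight s) (Ω-hasDerivative-L N (contract s) (ℕ.<-≤-trans lt ∣t∣≤N))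
      ... | inj₁ ≈1 = hasDerivative-cong (λ n → sym (vanish _)) (sym (vanish _)) hasDerivative-0
        where
        vanish : ∀ x → properWeight s * x ≈ 0#
        vanish x = trans (*-congʳ (trans (*-congʳ (trans (+-congˡ (-‿cong ≈1)) (-‿inverseʳ 1#))) (zeroˡ _))) (zeroˡ x)

    Ωᶠ-polynomial : ∀ u → Polynomial (λ n → Ωᶠ n u)
    Ωᶠ-polynomial []      = polynomial-const 1#
    Ωᶠ-polynomial (t ∷ u) =
      polynomial-* (hasDerivative⇒polynomial (Ω-hasDerivative-L (suc ∣ t ∣) t ℕ.≤-refl)) (Ωᶠ-polynomial u)

    -- Evaluation of L ⋆ δ• on forests and summation of the logarithm

    private
      ℋ⊗ℋCK-monomials : CommutativeMonoid _ _
      ℋ⊗ℋCK-monomials = DirectProduct.commutativeMonoid ℋ-monomials ℋCK-monomials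

      open CommutativeMonoid ℋ⊗ℋCK-monomials using (_∙_)

      Φ₁ : Tree → ℋ⊗ℋCK
      Φ₁ t = ∑ (subforests t) λ s → η (components s , [ contract s ])

      L⊗δ• : CommutativeMonoid.Carrier ℋ⊗ℋCK-monomials → Carrier
      L⊗δ• (i , j) = L S (η i) * δ• (η j)

    L⋆δ• : ∀ t → (L S ⋆ δ•) (η [ t ]) ≈ Lᵗ t
    L⋆δ• t = begin
      (L S ⋆ δ•) (η [ t ])
        ≈⟨ linearForm-μ ℋ⊗ℋCK-monomials L⊗δ• (Φ₁ t) (η ([] , [])) ⟩
      linearForm (λ i → L⊗δ• (i ∙ ([] , []))) (Φ₁ t)
        ≡⟨ linearForm-∑ _ (subforests t) (λ s → η (components s , [ contract s ])) ⟩
      Σˡ (subforests t) (λ s → L S (η (components s ++ [])) * δ• (η [ contract s ]))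
        ≈⟨ Σˡ-cong (subforests t) (λ s → *-cong
             (reflexive (≡.cong (λ m → L S (η m)) (List.++-identityʳ (components s))))
             (δ•≈ε (contractedBranches s))) ⟩
      Σˡ (subforests t) (λ s → L S (η (components s)) * ε (η (contractedBranches s)))
        ≈⟨ Σ-fullyKept t (λ s → L S (η (components s))) ⟩
      L S (η (components (fullSubforest t)))
        ≡⟨ ≡.cong (λ m → L S (η m)) (components-full t) ⟩
      Lᵗ t ∎
      where
      δ•≈ε : ∀ us → δ• (η [ B₊ us ]) ≈ ε (η us)
      δ•≈ε []      = refl
      δ•≈ε (_ ∷ _) = refl

    -- Contraction turns each tree into one tree, so the second tensor factor keeps at least two
    -- trees, and `δ•` kills it.
    L⋆δ•-0 : ∀ t t′ u → (L S ⋆ δ•) (η (t ∷ t′ ∷ u)) ≈ 0#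
    L⋆δ•-0 t t′ u = begin
      (L S ⋆ δ•) (η (t ∷ t′ ∷ u))
        ≈⟨ linearForm-μ ℋ⊗ℋCK-monomials L⊗δ• (Φ₁ t) (Φ (η (t′ ∷ u))) ⟩
      linearForm (λ i → linearForm (λ j → L⊗δ• (i ∙ j)) (Φ (η (t′ ∷ u)))) (Φ₁ t)
        ≡⟨ linearForm-∑ _ (subforests t) (λ s → η (components s , [ contract s ])) ⟩
      Σˡ (subforests t) (λ s →
        linearForm (λ j → L⊗δ• ((components s , [ contract s ]) ∙ j)) (Φ (η (t′ ∷ u))))
        ≈⟨ Σˡ-zero (subforests t) vanish ⟩
      0# ∎
      where
      δ•-0 : ∀ us v vs → δ• (η (B₊ us ∷ v ∷ vs)) ≈ 0#
      δ•-0 []      v vs = refl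
      δ•-0 (_ ∷ _) v vs = refl

      vanish : ∀ s → linearForm (λ j → L⊗δ• ((components s , [ contract s ]) ∙ j)) (Φ (η (t′ ∷ u))) ≈ 0#
      vanish s = begin
        linearForm g (Φ (η (t′ ∷ u)))
          ≈⟨ linearForm-μ ℋ⊗ℋCK-monomials g (Φ₁ t′) (Φ (η u)) ⟩
        linearForm (λ i → linearForm (λ j → g (i ∙ j)) (Φ (η u))) (Φ₁ t′)
          ≡⟨ linearForm-∑ _ (subforests t′) (λ s′ → η (components s′ , [ contract s′ ])) ⟩
        Σˡ (subforests t′) (λ s′ → linearForm (λ j → g ((components s′ , [ contract s′ ]) ∙ j)) (Φ (η u)))
          ≈⟨ Σˡ-zero (subforests t′) (λ s′ → linearForm-0
               (λ j → trans (*-congˡ (δ•-0 (contractedBranches s) (contract s′) (proj₂ j))) (zeroʳ _)) (Φ (η u))) ⟩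
        0# ∎
        where
        g : CommutativeMonoid.Carrier ℋ⊗ℋCK-monomials → Carrier
        g j = L⊗δ• ((components s , [ contract s ]) ∙ j)

    Ωᶠ-derivative : ∀ u →
      IsSumOf ((L S ⋆ δ•) (η u)) (λ n → ((- 1#) ^ suc (suc n) * 1/ (suc n)) * diff (suc n) (λ m → Ωᶠ m u) 0)
    Ωᶠ-derivative []           =
      -- On the empty forest `Ωᶠ` is constantly 1, so its differences of positive order vanish.
      isSumOf-cong (sym (zeroʳ _)) (λ _ → refl) (isSumOf-0 λ n → trans (*-congˡ (diff-const n 1# 0)) (zeroʳ _))
    Ωᶠ-derivative (t ∷ [])     = newton (λ n → 1/ (suc n)) (λ n → 1/-inverse (suc n))
      (hasDerivative-cong (λ n → sym (*-identityʳ _)) (sym (L⋆δ• t)) (Ω-hasDerivative-L (suc ∣ t ∣) t ℕ.≤-refl))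
    Ωᶠ-derivative (t ∷ t′ ∷ u) = newton (λ n → 1/ (suc n)) (λ n → 1/-inverse (suc n)) derivative
      where
      derivative : HasDerivative (λ n → Ωᶠ n (t ∷ t′ ∷ u)) ((L S ⋆ δ•) (η (t ∷ t′ ∷ u)))
      derivative = hasDerivative-cong (λ _ → refl)
        -- The second tree contributes `Ω 0 t′`, which is 0.
        (trans (trans (*-congˡ (zeroˡ (Ωᶠ 0 u))) (zeroʳ (Lᵗ t))) (sym (L⋆δ•-0 t t′ u)))
        (hasDerivative-*ʳ (Ω-hasDerivative-L (suc ∣ t ∣) t ℕ.≤-refl) (Ωᶠ-polynomial (t′ ∷ u)))

    -- Both sides are linear in x, so forests suffice; the number of terms depends on x, and `⊕`
    -- adds the two bounds.
    L⋆δ•-isSumOf-logTerms : ∀ x → IsSumOf ((L S ⋆ δ•) x) (λ n → logTerm δ (suc n) x)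
    L⋆δ•-isSumOf-logTerms (η u)   =
      isSumOf-cong refl (λ n → *-congˡ (sym ([δ-ε]^∗ (suc n) u))) (Ωᶠ-derivative u)
    L⋆δ•-isSumOf-logTerms 𝟎       = isSumOf-0 λ n → zeroʳ _
    L⋆δ•-isSumOf-logTerms (x ⊕ y) = isSumOf-cong refl (λ n → sym (distribˡ _ _ _))
      (isSumOf-+ (L⋆δ•-isSumOf-logTerms x) (L⋆δ•-isSumOf-logTerms y))
    L⋆δ•-isSumOf-logTerms (r ⊙ x) = isSumOf-cong refl
      (λ n → solve 3 (λ r a b → r :* (a :* b) := a :* (r :* b)) refl r _ _)
      (isSumOf-*ˡ r (L⋆δ•-isSumOf-logTerms x))

    L⋆δ•≈log∗δ : (L S ⋆ δ•) ≈log∗ δ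
    L⋆δ•≈log∗δ x =
      let N , vanish , total = L⋆δ•-isSumOf-logTerms x
      -- `suc n > N` unfolds to `suc N ≤ suc n`, which is the bound on the shifted index.
      in N , (λ { n (s≤s N≤n) → vanish n N≤n }) , total

mainTheorem11 : ∀ {c ℓ₁ ℓ₂} (k : HeytingField c ℓ₁ ℓ₂) (char0 : CharacteristicZero k) →
    let open TreeHopfAlgebras k char0 in
    (S : ℋ → ℋ) → IsAntipode S → (L S ⋆ δ•) ≈log∗ δ
mainTheorem11 = OrderPolynomials.L⋆δ•≈log∗δ
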